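{- Let $\lambda,\mu,\nu,\delta,\rho$ be partitions with nonnegative parts (at most $n$ parts), $M\in\mathrm{HIVE}^\rho_{\lambda\delta}$, $N\in\mathrm{HIVE}^\delta_{\mu\nu}$, and let $P,Q$ be the hives produced from $(M,N)$ by the octahedron recurrence as in the context. Then $$R(\widehat M,\widehat N)=\widehat P\qquad\text{and}\qquad J(\widehat M\star\widehat N)=\widehat Q.$$
   Context: Let $\Delta_n=\{(x,y,z)\in\mathbb Z_{\ge0}^3:x+y+z=n\}$. A function $P:\Delta_n\to\mathbb Z$ satisfies the hive condition if (whenever all points lie in $\Delta_n$) (i) $P(x,y,z)+P(x,y+1,z-1)\ge P(x+1,y,z-1)+P(x-1,y+1,z)$, (ii) $P(x,y,z)+P(x+1,y,z-1)\ge P(x,y+1,z-1)+P(x+1,y-1,z)$, (iii) $P(x,y,z)+P(x+1,y-1,z)\ge P(x+1,y,z-1)+P(x,y-1,z+1)$; a hive is such a function modulo constants. $\mathrm{HIVE}^\nu_{\lambda\mu}$: hives with $\lambda_k=P(n-k,k,0)-P(n-k+1,k-1,0)$, $\mu_k=P(k,0,n-k)-P(k-1,0,n-k+1)$, $\nu_k=P(0,k,n-k)-P(0,k-1,n-k+1)$. Construction of $P,Q$: choose representatives with $M(k,0,n-k)=N(0,k,n-k)$ for all $k$. Let $\mathcal L=\{(x,y,t)\in\mathbb Z^3:0\le x,y\le n,\ x+y+t\text{ even}\}$. Define $f$ on the points with $t=|x-y|$ by $f(x,n-z,y)=M(x,y,z)$ and $f(n-z,y,x)=N(x,y,z)$,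 $(x,y,z)\in\Delta_n$. Extend $f$, inductively in $t$, to all points of $\mathcal L$ in $A=\{|x-y|\le t\le n-|n-x-y|\}$ by $f(x,y,t+1)=\max(f(x+1,y,t)+f(x-1,y,t),f(x,y+1,t)+f(x,y-1,t))-f(x,y,t-1)$. Set $P(x,y,z)=f(n-y,n-z,n-x)$ and $Q(x,y,z)=f(x,y,n-z)$. For any $P:\Delta_n\to\mathbb Z$, $\widehat P(i,j)=P(i-j,j,n-i)-P(i-j+1,j-1,n-i)$, $1\le j\le i\le n$; for hives this is a Gelfand–Tsetlin pattern, identified with the tableau $T$ (entries in $\{1..n\}$, rows weakly and columns strictly increasing) with $T(i,j)=\#\{\text{entries}\le i\text{ in row }j\}$; $\widehat M$ has shape $\lambda$ and $\widehat N$ has shape $\mu$. For tableaux $T$ (shape $\lambda$), $U$ (shape $\mu$): $T\star U$ is the skew tableau with $U$ up and to the right of $T$ (rows $r\le n$: row $r$ of $U$ in columns $\lambda_1+1..\lambda_1+\mu_r$; rows $n+r$: row $r$ of $T$ in columns $1..\lambda_r$); $J(X)$ is jeu de taquin rectification. $J^n=T$, $J^{k-1}=((J^k\leftarrow a_1)\leftarrow\cdots)\leftarrow a_l$ with $a_1\le\dots\le a_l$ the entries of row $k$ of $U$ ($\leftarrow$ = row insertion); $\lambda^k$ = shape of $J^k$; $R(T,U)(i,j)=\sum_{r\ge j}\lambda^{i-j+1}_r-\sum_{r\ge j+1}\lambda^{i-j}_r$. -}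

module Defs where

open import Data.Nat as ℕ using (ℕ; zero; suc; _∸_; _≤ᵇ_; _≡ᵇ_)
open import Data.Integer as ℤ using (ℤ; +_; ∣_∣)
open import Data.Bool using (Bool; true; false; if_then_else_)
open import Data.Maybe using (Maybe; just; nothing)
open import Data.Product using (_×_; _,_)
open import Data.List using (List; []; _∷_; _++_; map; concatMap; replicate;
  applyUpTo; length; foldl; drop; catMaybes; [_])
open import Data.Nat.ListAction using (sum)
open import Relation.Binary.PropositionalEquality using (_≡_)

-- Functions on the triangle Δ_n are modelled as total functions
-- ℕ → ℕ → ℕ → ℤ ; only their values at points (x,y,z) with
-- x + y + z = n are ever used.

TriFun : Set
TriFun = ℕ → ℕ → ℕ → ℤ

-- Hive condition (i),(ii),(iii), imposed whenever all four points lie in Δ_n.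
-- Shifted variables (a = x-1, b = y-1, c = z-1) avoid truncated subtraction.
record IsHive (n : ℕ) (P : TriFun) : Set where
  field
    hive-i   : ∀ a y c → a ℕ.+ y ℕ.+ c ℕ.+ 2 ≡ n →
               P (suc (suc a)) y c ℤ.+ P a (suc y) (suc c)
                 ℤ.≤ P (suc a) y (suc c) ℤ.+ P (suc a) (suc y) c
    hive-ii  : ∀ x b c → x ℕ.+ b ℕ.+ c ℕ.+ 2 ≡ n →
               P x (suc (suc b)) c ℤ.+ P (suc x) b (suc c)
                 ℤ.≤ P x (suc b) (suc c) ℤ.+ P (suc x) (suc b) c
    hive-iii : ∀ x b c → x ℕ.+ b ℕ.+ c ℕ.+ 2 ≡ n →
               P (suc x) (suc b) c ℤ.+ P x b (suc (suc c))
                 ℤ.≤ P x (suc b) (suc c) ℤ.+ P (suc x) b (suc c)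

-- Boundary conditions of HIVE^ν_{λμ}: partitions are functions ℕ → ℕ,
-- of which only the parts with index 1..n are used.
record InHIVE (n : ℕ) (nu lam mu : ℕ → ℕ) (P : TriFun) : Set where
  field
    hive      : IsHive n P
    bdry-lam  : ∀ k → 1 ℕ.≤ k → k ℕ.≤ n →
                P (n ∸ k) k 0 ℤ.- P (suc (n ∸ k)) (k ∸ 1) 0 ≡ + lam k
    bdry-mu   : ∀ k → 1 ℕ.≤ k → k ℕ.≤ n →
                P k 0 (n ∸ k) ℤ.- P (k ∸ 1) 0 (suc (n ∸ k)) ≡ + mu k
    bdry-nu   : ∀ k → 1 ℕ.≤ k → k ℕ.≤ n →
                P 0 k (n ∸ k) ℤ.- P 0 (k ∸ 1) (suc (n ∸ k)) ≡ + nu k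

IsPartition : ℕ → (ℕ → ℕ) → Set
IsPartition n lam = ∀ k → 1 ℕ.≤ k → k ℕ.< n → lam (suc k) ℕ.≤ lam k

dist : ℕ → ℕ → ℕ
dist x y = (x ∸ y) ℕ.+ (y ∸ x)

-- initial values on t = |x - y| :
--   f(x, n-z, y) = M(x,y,z)   (points with x ≤ y)
--   f(n-z, y, x) = N(x,y,z)   (points with x ≥ y; agree on x = y by hypothesis)
octBase : ℕ → TriFun → TriFun → ℕ → ℕ → ℤ
octBase n M N x y =
  if x ≤ᵇ y then M x (y ∸ x) (n ∸ y) else N (x ∸ y) y (n ∸ x)

-- f(t, x, y) ; for t ≤ |x-y| the initial value, otherwise
-- f(x,y,t+1) = max(f(x+1,y,t)+f(x-1,y,t), f(x,y+1,t)+f(x,y-1,t)) - f(x,y,t-1).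
-- (Values at points outside A or of the wrong parity are never used.)
octF : ℕ → TriFun → TriFun → ℕ → ℕ → ℕ → ℤ
octF n M N zero x y = octBase n M N x y
octF n M N (suc zero) x y = octBase n M N x y
octF n M N (suc (suc t)) x y =
  if suc (suc t) ≤ᵇ dist x y then octBase n M N x y
  else ((octF n M N (suc t) (suc x) y ℤ.+ octF n M N (suc t) (x ∸ 1) y)
          ℤ.⊔ (octF n M N (suc t) x (suc y) ℤ.+ octF n M N (suc t) x (y ∸ 1)))
       ℤ.- octF n M N t x y

octf : ℕ → TriFun → TriFun → ℕ → ℕ → ℕ → ℤ
octf n M N x y t = octF n M N t x y

octP : ℕ → TriFun → TriFun → TriFun
octP n M N x y z = octf n M N (n ∸ y) (n ∸ z) (n ∸ x)

octQ : ℕ → TriFun → TriFun → TriFun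
octQ n M N x y z = octf n M N x y (n ∸ z)

hat : ℕ → TriFun → ℕ → ℕ → ℤ
hat n P i j = P (i ∸ j) j (n ∸ i) ℤ.- P (suc (i ∸ j)) (j ∸ 1) (n ∸ i)

-- Tableaux: lists of rows (top row first), each row a weakly increasing list.

Tableau : Set
Tableau = List (List ℕ)

fromTo : ℕ → ℕ → List ℕ
fromTo a b = applyUpTo (a ℕ.+_) (suc b ∸ a)

-- Tableau of a Gelfand–Tsetlin pattern G (G(i,j), 1 ≤ j ≤ i ≤ n):
-- row j contains G(i,j) - G(i-1,j) copies of i  (with G(j-1,j) := 0),
-- so that #{entries ≤ i in row j} = G(i,j).
gtRow : ℕ → (ℕ → ℕ → ℤ) → ℕ → List ℕ
gtRow n G j = concatMap (λ i → replicate ∣ G i j ℤ.- prev i ∣ i) (fromTo j n)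
  where
  prev : ℕ → ℤ
  prev i = if i ≡ᵇ j then + 0 else G (i ∸ 1) j

gtTableau : ℕ → (ℕ → ℕ → ℤ) → Tableau
gtTableau n G = map (gtRow n G) (fromTo 1 n)

rowAt : Tableau → ℕ → List ℕ
rowAt [] j = []
rowAt (r ∷ rs) zero = []
rowAt (r ∷ rs) (suc zero) = r
rowAt (r ∷ rs) (suc (suc j)) = rowAt rs (suc j)

countLE : ℕ → List ℕ → ℕ
countLE i [] = 0
countLE i (x ∷ xs) = if x ≤ᵇ i then suc (countLE i xs) else countLE i xs

bump : List ℕ → ℕ → List ℕ × Maybe ℕ
bump [] a = [ a ] , nothing
bump (x ∷ xs) a with suc a ≤ᵇ x
... | true  = (a ∷ xs) , just x
... | false with bump xs a
...   | ys , m = (x ∷ ys) , m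

rowInsert : Tableau → ℕ → Tableau
rowInsert [] a = [ [ a ] ]
rowInsert (row ∷ rows) a with bump row a
... | row' , nothing = row' ∷ rows
... | row' , just b  = row' ∷ rowInsert rows b

insertList : Tableau → List ℕ → Tableau
insertList = foldl rowInsert

-- R(T,U).  J^n = T, J^{k-1} = J^k ← (row k of U).
-- Jm m = J^{n-m}, so J^k = Jm (n - k) for 0 ≤ k ≤ n.

Jm : ℕ → Tableau → Tableau → ℕ → Tableau
Jm n T U zero = T
Jm n T U (suc m) = insertList (Jm n T U m) (rowAt U (n ∸ m))

Jk : ℕ → Tableau → Tableau → ℕ → Tableau
Jk n T U k = Jm n T U (n ∸ k)

tailSum : Tableau → ℕ → ℕ
tailSum t j = sum (map length (drop (j ∸ 1) t))

Rpat : ℕ → Tableau → Tableau → ℕ → ℕ → ℤ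
Rpat n T U i j =
  + tailSum (Jk n T U (suc (i ∸ j))) j ℤ.- + tailSum (Jk n T U (i ∸ j)) (suc j)

-- Skew tableaux and jeu de taquin.
-- A skew tableau is a list of rows; each row is a list of cells,
-- `nothing` = cell of the inner shape (empty), `just v` = entry v.

Grid : Set
Grid = List (List (Maybe ℕ))

star : Tableau → Tableau → Grid
star T U = map (λ u → replicate lam1 nothing ++ map just u) U ++ map (map just) T
  where
  lam1 : ℕ
  lam1 = length (rowAt T 1)

getRow : List (Maybe ℕ) → ℕ → Maybe ℕ
getRow [] c = nothing
getRow (x ∷ xs) zero = x
getRow (x ∷ xs) (suc c) = getRow xs c

getCell : Grid → ℕ → ℕ → Maybe ℕ
getCell [] r c = nothing
getCell (row ∷ g) zero c = getRow row c
getCell (row ∷ g) (suc r) c = getCell g r c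

setRow : List (Maybe ℕ) → ℕ → Maybe ℕ → List (Maybe ℕ)
setRow [] c v = []
setRow (x ∷ xs) zero v = v ∷ xs
setRow (x ∷ xs) (suc c) v = x ∷ setRow xs c v

setCell : Grid → ℕ → ℕ → Maybe ℕ → Grid
setCell [] r c v = []
setCell (row ∷ g) zero c v = setRow row c v ∷ g
setCell (row ∷ g) (suc r) c v = row ∷ setCell g r c v

takeRow : List (Maybe ℕ) → ℕ → List (Maybe ℕ)
takeRow xs zero = []
takeRow [] (suc c) = []
takeRow (x ∷ xs) (suc c) = x ∷ takeRow xs c

truncCell : Grid → ℕ → ℕ → Grid
truncCell [] r c = []
truncCell (row ∷ g) zero c = takeRow row c ∷ g
truncCell (row ∷ g) (suc r) c = row ∷ truncCell g r c

-- One jeu de taquin slide into the empty cell (r,c) (0-indexed).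
-- The hole is filled by the smaller of its neighbours below / to the right,
-- the one below if they are equal; when it has no such neighbour the
-- cell is removed.  The first argument is fuel (a bound on the length of
-- the slide, always chosen large enough).
slide : ℕ → Grid → ℕ → ℕ → Grid
slide zero g r c = g
slide (suc k) g r c with getCell g (suc r) c | getCell g r (suc c)
... | nothing | nothing = truncCell g r c
... | just b  | nothing = slide k (setCell (setCell g r c (just b)) (suc r) c nothing) (suc r) c
... | nothing | just a  = slide k (setCell (setCell g r c (just a)) r (suc c) nothing) r (suc c)
... | just b  | just a  with b ≤ᵇ a
...   | true  = slide k (setCell (setCell g r c (just b)) (suc r) c nothing) (suc r) c
...   | false = slide k (setCell (setCell g r c (just a)) r (suc c) nothing) r (suc c)

offset : List (Maybe ℕ) → ℕ
offset [] = 0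
offset (nothing ∷ xs) = suc (offset xs)
offset (just _ ∷ xs) = 0

-- an inner corner: the last inner cell of the lowest row containing inner cells
findCorner : Grid → Maybe (ℕ × ℕ)
findCorner g = go g 0 nothing
  where
  go : Grid → ℕ → Maybe (ℕ × ℕ) → Maybe (ℕ × ℕ)
  go [] r acc = acc
  go (row ∷ rows) r acc with offset row
  ... | zero  = go rows (suc r) acc
  ... | suc o = go rows (suc r) (just (r , o))

gridSize : Grid → ℕ
gridSize g = length g ℕ.+ sum (map length g)

-- repeat slides into inner corners until no inner cell is left
-- (first argument: fuel, a bound on the number of slides)
rectifyGrid : ℕ → Grid → Grid
rectifyGrid zero g = g
rectifyGrid (suc k) g with findCorner g
... | nothing = g
... | just (r , c) = rectifyGrid k (slide (suc (gridSize g)) g r c)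

J : Grid → Tableau
J g = map catMaybes (rectifyGrid (gridSize g) g)

{-# OPTIONS --safe #-}

-- Inserting a sorted word into a sorted row is a max-plus recurrence for the numbers
-- of letters ≤ i.  For k ≤ i-j the pattern of J^k is
--   J^k(i,j) = f(i-j, k+j, i-k) - f(i-j+1, k+j-1, i-k),
-- and the number of letters ≤ i bumped into row j while row k of U is inserted is
--   f(i-j+1, k+j-1, i-k) - f(i-j+1, k+j-2, i-k+1);
-- with these values the insertion recurrence is exactly the octahedron recurrence at
-- (i-j, k+j-1, i-k).  At k = 0 this is the pattern of Q, and at i = n the row lengths
-- telescope to the pattern of P.
--
-- For jeu de taquin, rectify the rows of U from the last to the first.  A slide
-- changes the top row v and the tableau S below it, but not S ← v, and once v has
-- reached the left margin, S ← v is v placed on top of S.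
module Submission where

open import Defs
open import Data.Bool using (true; false; if_then_else_)
open import Data.Bool.Properties using (T-≡; ¬-not)
open import Data.Integer as ℤ using (ℤ; +_; ∣_∣)
import Data.Integer.Properties as ℤ
open import Data.Integer.Tactic.RingSolver using (solve-∀)
open import Data.List using (List; []; _∷_; _++_; [_]; applyUpTo; catMaybes; concatMap; drop; head; length; map; replicate)
open import Data.List.Properties using (++-assoc; ++-identityʳ; drop-drop; length-++; length-applyUpTo; length-map; length-replicate; map-++; map-applyUpTo)
open import Data.List.Relation.Binary.Pointwise as Pointwise using (Pointwise; []; _∷_)
open import Data.List.Relation.Binary.Prefix.Heterogeneous using (Prefix; []; _∷_)
import Data.List.Relation.Binary.Prefix.Heterogeneous.Properties as Prefix
open import Data.List.Relation.Binary.Sublist.Heterogeneous as Sub using (Sublist; []; _∷_; _∷ʳ_)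
import Data.List.Relation.Binary.Sublist.Heterogeneous.Properties as Sub
open import Data.List.Relation.Unary.All as All using (All; []; _∷_)
import Data.List.Relation.Unary.All.Properties as All
open import Data.List.Relation.Unary.AllPairs using (AllPairs; []; _∷_)
import Data.List.Relation.Unary.AllPairs.Properties as AllPairs
open import Data.Maybe using (Maybe; just; nothing)
import Data.Maybe.Relation.Unary.All as Maybe
open import Data.Nat
open import Data.Nat.ListAction using (sum)
open import Data.Nat.Properties
open import Data.Nat.Tactic.RingSolver renaming (solve-∀ to solveℕ)
open import Data.Product using (_×_; _,_; proj₁; proj₂; ∃; ∃₂)
open import Data.Sum using (_⊎_; inj₁; inj₂)
open import Data.Unit using (⊤; tt)
open import Function using (_∘_; id)
open import Function.Bundles using (Equivalence)
open import Relation.Binary.PropositionalEquality hiding ([_]; J)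
open import Relation.Nullary using (yes; no; contradiction)

-- The region A is a tetrahedron with M and N on its lower faces and P and Q on its upper ones, and
-- the insertions sweep it slice by slice in k. The pattern of T is the face of M, the counts of row
-- k of U lie on the face of N, J^0 lies on the face of Q, and the letter bound i = n cuts out the
-- face of P. The recurrence in i has to start somewhere, and a threshold decides where: the letters
-- of row k of U are at least k, and a bumped letter is strictly larger than the letter that bumps
-- it, so a word entering row j has only letters ≥ k + j - 1. The counts of smaller letters are
-- still those of T, hence initial values of f. Rows and bumped words are carried along together:
-- the new row is computed from the arriving word, and the word for the next row from the new row.

-- Merging a sorted word into a sorted row

Sorted : List ℕ → Set
Sorted = AllPairs _≤_

infix 4 _⊑_
_⊑_ : List ℕ → List ℕ → Set
_⊑_ = Sublist _≡_

-- RowIns s w t b: inserting the sorted word w into the row s leaves the row t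
-- and bumps the word b.  As w is sorted, the insertion is a single merging pass
-- through s, and b is visibly a subword of s.
data RowIns : (s w t b : List ℕ) → Set where
  extend : ∀ {w} → RowIns [] w w []
  done   : ∀ {x s} → RowIns (x ∷ s) [] (x ∷ s) []
  bumps  : ∀ {x s a w t b} → a < x → RowIns s w t b →
           RowIns (x ∷ s) (a ∷ w) (a ∷ t) (x ∷ b)
  passes : ∀ {x s a w t b} → x ≤ a → RowIns s (a ∷ w) t b →
           RowIns (x ∷ s) (a ∷ w) (x ∷ t) b

rowIns : ∀ s w → ∃₂ (RowIns s w)
rowIns []      w  = _ , _ , extend
rowIns (x ∷ s) [] = _ , _ , done
rowIns (x ∷ s) (a ∷ w) with a <? x
... | yes a<x with _ , _ , r ← rowIns s w = _ , _ , bumps a<x r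
... | no  a≮x with _ , _ , r ← rowIns s (a ∷ w) = _ , _ , passes (≮⇒≥ a≮x) r

newRow bumped : List ℕ → List ℕ → List ℕ
newRow s w = proj₁ (rowIns s w)
bumped s w = proj₁ (proj₂ (rowIns s w))

rowIns-graph : ∀ s w → RowIns s w (newRow s w) (bumped s w)
rowIns-graph s w = proj₂ (proj₂ (rowIns s w))

-- The comparison of the two heads decides which rule applies. This allows a derivation built by
-- hand to be identified with the values of `newRow` and `bumped`.
RowIns-functional : ∀ {s w t b t′ b′} → RowIns s w t b → RowIns s w t′ b′ → t ≡ t′ × b ≡ b′
RowIns-functional extend extend = refl , refl
RowIns-functional done done = refl , refl
RowIns-functional (bumps _ p) (bumps _ q) with RowIns-functional p q
... | refl , refl = refl , refl
RowIns-functional (bumps a<x _) (passes x≤a _) = contradiction a<x (≤⇒≯ x≤a)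
RowIns-functional (passes x≤a _) (bumps a<x _) = contradiction a<x (≤⇒≯ x≤a)
RowIns-functional (passes _ p) (passes _ q) with RowIns-functional p q
... | refl , refl = refl , refl

RowIns⇒newRow : ∀ {s w t b} → RowIns s w t b → newRow s w ≡ t
RowIns⇒newRow r = proj₁ (RowIns-functional (rowIns-graph _ _) r)

RowIns⇒bumped : ∀ {s w t b} → RowIns s w t b → bumped s w ≡ b
RowIns⇒bumped r = proj₂ (RowIns-functional (rowIns-graph _ _) r)

RowIns-⊑ : ∀ {s w t b} → RowIns s w t b → b ⊑ s
RowIns-⊑ extend       = []
RowIns-⊑ done         = Sub.minimum _
RowIns-⊑ (bumps _ r)  = refl ∷ RowIns-⊑ r
RowIns-⊑ (passes _ r) = _ ∷ʳ RowIns-⊑ r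

RowIns-All : ∀ {P : ℕ → Set} {s w t b} → RowIns s w t b → All P s → All P w → All P t
RowIns-All extend       _          pw         = pw
RowIns-All done         ps         _          = ps
RowIns-All (bumps _ r)  (_ ∷ ps)   (pa ∷ pw)  = pa ∷ RowIns-All r ps pw
RowIns-All (passes _ r) (px ∷ ps)  pw         = px ∷ RowIns-All r ps pw

⊑-All : ∀ {P : ℕ → Set} {xs ys} → xs ⊑ ys → All P ys → All P xs
⊑-All []         _        = []
⊑-All (_ ∷ʳ s)   (_ ∷ p)  = ⊑-All s p
⊑-All (refl ∷ s) (px ∷ p) = px ∷ ⊑-All s p

⊑-Sorted : ∀ {xs ys} → xs ⊑ ys → Sorted ys → Sorted xs
⊑-Sorted []         _        = []
⊑-Sorted (_ ∷ʳ s)   (_ ∷ p)  = ⊑-Sorted s p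
⊑-Sorted (refl ∷ s) (px ∷ p) = ⊑-All s px ∷ ⊑-Sorted s p

≤-All : ∀ {a b xs} → a ≤ b → All (b ≤_) xs → All (a ≤_) xs
≤-All a≤b = All.map (≤-trans a≤b)

RowIns-Sorted : ∀ {s w t b} → RowIns s w t b → Sorted s → Sorted w → Sorted t
RowIns-Sorted extend _ w = w
RowIns-Sorted done s _ = s
RowIns-Sorted (bumps a<x r) (x≤ ∷ s) (a≤ ∷ w) =
  RowIns-All r (≤-All (<⇒≤ a<x) x≤) a≤ ∷ RowIns-Sorted r s w
RowIns-Sorted (passes x≤a r) (x≤ ∷ s) (a≤ ∷ w) =
  RowIns-All r x≤ (x≤a ∷ ≤-All x≤a a≤) ∷ RowIns-Sorted r s (a≤ ∷ w)

-- Schensted insertion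

bumpAll : List ℕ → List ℕ → List ℕ × List ℕ
bumpAll s []      = s , []
bumpAll s (a ∷ w) with bump s a
... | s′ , nothing = bumpAll s′ w
... | s′ , just b  = proj₁ (bumpAll s′ w) , b ∷ proj₂ (bumpAll s′ w)

≤ᵇ-true : ∀ {m n} → m ≤ n → (m ≤ᵇ n) ≡ true
≤ᵇ-true m≤n = Equivalence.to T-≡ (≤⇒≤ᵇ m≤n)

≤ᵇ-false : ∀ {m n} → n < m → (m ≤ᵇ n) ≡ false
≤ᵇ-false {m} {n} n<m = ¬-not (λ eq → <⇒≱ n<m (≤ᵇ⇒≤ m n (Equivalence.from T-≡ eq)))

bump-< : ∀ {a x} s → a < x → bump (x ∷ s) a ≡ (a ∷ s , just x)
bump-< s a<x rewrite ≤ᵇ-true a<x = refl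

bump-≥ : ∀ {a x} s → x ≤ a → bump (x ∷ s) a ≡ (x ∷ proj₁ (bump s a) , proj₂ (bump s a))
bump-≥ s x≤a rewrite ≤ᵇ-false (s≤s x≤a) = refl

-- A letter that is at most every letter of the word is never bumped and can be set aside. Schensted
-- insertion starts again at the left for each letter; setting heads aside turns it into the single
-- pass of `RowIns`.
bumpAll-passes : ∀ {x} s {w} → All (x ≤_) w →
  bumpAll (x ∷ s) w ≡ (x ∷ proj₁ (bumpAll s w) , proj₂ (bumpAll s w))
bumpAll-passes s [] = refl
bumpAll-passes {x} s (_∷_ {a} {w} x≤a x≤w) with bump (x ∷ s) a | bump-≥ s x≤a
... | _ | refl with bump s a
...   | s′ , nothing = bumpAll-passes s′ x≤w
...   | s′ , just b rewrite bumpAll-passes s′ x≤w = refl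

RowIns-bumpAll : ∀ {s w t b} → Sorted w → RowIns s w t b → bumpAll s w ≡ (t , b)
RowIns-bumpAll {w = []} _ extend = refl
RowIns-bumpAll (a≤w ∷ w↗) extend
  rewrite bumpAll-passes [] a≤w | RowIns-bumpAll w↗ extend = refl
RowIns-bumpAll _ done = refl
RowIns-bumpAll {x ∷ s} {a ∷ w} (a≤w ∷ w↗) (bumps a<x r)
  rewrite bump-< s a<x | bumpAll-passes s a≤w | RowIns-bumpAll w↗ r = refl
RowIns-bumpAll {x ∷ s} (a≤w ∷ w↗) (passes x≤a r)
  rewrite bumpAll-passes s (x≤a ∷ ≤-All x≤a a≤w) | RowIns-bumpAll (a≤w ∷ w↗) r = refl

-- The first row never meets the letters bumped out of it again, so they may be collected into one
-- word before any of them enters the rows below. Insertion thus proceeds row by row instead of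
-- letter by letter.
insertList-∷ : ∀ s S w →
  insertList (s ∷ S) w ≡ proj₁ (bumpAll s w) ∷ insertList S (proj₂ (bumpAll s w))
insertList-∷ s S [] = refl
insertList-∷ s S (a ∷ w) with bump s a
... | s′ , nothing = insertList-∷ s′ S w
... | s′ , just b  = insertList-∷ s′ (rowInsert S b) w

-- Tableaux as infinite sequences of rows

Rows : Set
Rows = ℕ → List ℕ

-- Rows past the end read as empty, so the creation of a new row is not a special case. Rows count
-- from 0 here and from 1 in `rowAt`.
rows : Tableau → Rows
rows T j = rowAt T (suc j)

wordInto : Rows → List ℕ → ℕ → List ℕ
wordInto S w zero    = w
wordInto S w (suc j) = bumped (S j) (wordInto S w j)

insertWord : Rows → List ℕ → Rows
insertWord S w j = newRow (S j) (wordInto S w j)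

wordInto-cong : ∀ {S S′} → (∀ j → S j ≡ S′ j) → ∀ w j → wordInto S w j ≡ wordInto S′ w j
wordInto-cong S≈ w zero = refl
wordInto-cong S≈ w (suc j) = cong₂ bumped (S≈ j) (wordInto-cong S≈ w j)

insertWord-cong : ∀ {S S′} → (∀ j → S j ≡ S′ j) → ∀ w j → insertWord S w j ≡ insertWord S′ w j
insertWord-cong S≈ w j = cong₂ newRow (S≈ j) (wordInto-cong S≈ w j)

wordInto-suc : ∀ S w j → wordInto S w (suc j) ≡ wordInto (S ∘ suc) (bumped (S 0) w) j
wordInto-suc S w zero    = refl
wordInto-suc S w (suc j) = cong (bumped (S (suc j))) (wordInto-suc S w j)

insertWord-suc : ∀ S w j → insertWord S w (suc j) ≡ insertWord (S ∘ suc) (bumped (S 0) w) j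
insertWord-suc S w j = cong (newRow (S (suc j))) (wordInto-suc S w j)

wordInto-Sorted : ∀ {S w} → (∀ j → Sorted (S j)) → Sorted w → ∀ j → Sorted (wordInto S w j)
wordInto-Sorted S↗ w↗ zero    = w↗
wordInto-Sorted S↗ w↗ (suc j) = ⊑-Sorted (RowIns-⊑ (rowIns-graph _ _)) (S↗ j)

insertWord-empty : ∀ j → insertWord (λ _ → []) [] j ≡ []
wordInto-empty : ∀ j → wordInto (λ _ → []) [] j ≡ []
wordInto-empty zero = refl
wordInto-empty (suc j) = refl
insertWord-empty zero = refl
insertWord-empty (suc j) = refl

rows-[s] : ∀ w j → rows (w ∷ []) j ≡ insertWord (λ _ → []) w j
rows-[s] w zero    = refl
rows-[s] w (suc j) = sym (trans (insertWord-suc (λ _ → []) w j) (insertWord-empty j))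

rows-insertList : ∀ S w → (∀ j → Sorted (rows S j)) → Sorted w →
  ∀ j → rows (insertList S w) j ≡ insertWord (rows S) w j
rows-insertList [] []      _ _ j = sym (insertWord-empty j)
rows-insertList [] (a ∷ w) _ (a≤w ∷ w↗) j
  rewrite insertList-∷ (a ∷ []) [] w | bumpAll-passes [] a≤w | RowIns-bumpAll w↗ extend
  = rows-[s] (a ∷ w) j
rows-insertList (s ∷ S) w S↗ w↗ j
  rewrite insertList-∷ s S w | RowIns-bumpAll w↗ (rowIns-graph s w) with j
... | zero  = refl
... | suc j = trans (rows-insertList S (bumped s w) (S↗ ∘ suc) (wordInto-Sorted S↗ w↗ 1) j)
                    (sym (insertWord-suc (rows (s ∷ S)) w j))

-- Counting letters

cnt-≤ : ∀ {i x} xs → x ≤ i → countLE i (x ∷ xs) ≡ suc (countLE i xs)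
cnt-≤ xs x≤i rewrite ≤ᵇ-true x≤i = refl

cnt-> : ∀ {i x} xs → i < x → countLE i (x ∷ xs) ≡ countLE i xs
cnt-> xs i<x rewrite ≤ᵇ-false i<x = refl

cnt-zero : ∀ {i xs} → All (i <_) xs → countLE i xs ≡ 0
cnt-zero [] = refl
cnt-zero (_∷_ {x} {xs} i<x p) = trans (cnt-> xs i<x) (cnt-zero p)

cnt-length : ∀ {i xs} → All (_≤ i) xs → countLE i xs ≡ length xs
cnt-length [] = refl
cnt-length (_∷_ {x} {xs} x≤i p) = trans (cnt-≤ xs x≤i) (cong suc (cnt-length p))

cnt-mono : ∀ {i k} → i ≤ k → ∀ xs → countLE i xs ≤ countLE k xs
cnt-mono i≤k [] = z≤n
cnt-mono {i} {k} i≤k (x ∷ xs) with x ≤? i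
... | yes x≤i rewrite ≤ᵇ-true x≤i | ≤ᵇ-true (≤-trans x≤i i≤k) = s≤s (cnt-mono i≤k xs)
... | no x≰i rewrite ≤ᵇ-false (≰⇒> x≰i) with x ≤ᵇ k
...   | true  = m≤n⇒m≤1+n (cnt-mono i≤k xs)
...   | false = cnt-mono i≤k xs

cnt-++ : ∀ i xs ys → countLE i (xs ++ ys) ≡ countLE i xs + countLE i ys
cnt-++ i [] ys = refl
cnt-++ i (x ∷ xs) ys with x ≤ᵇ i
... | true  = cong suc (cnt-++ i xs ys)
... | false = cnt-++ i xs ys

-- Letters are moved, never created or lost. Once the new row is known, this determines the bumped
-- word.
RowIns-cnt : ∀ {s w t b} → RowIns s w t b → ∀ i →
  countLE i t + countLE i b ≡ countLE i s + countLE i w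
RowIns-cnt {w = w} extend i = +-identityʳ _
RowIns-cnt done i = refl
RowIns-cnt (bumps {x} {s} {a} {w} {t} {b} _ r) i with a ≤ᵇ i | x ≤ᵇ i
... | true  | true  = cong suc (trans (+-suc _ _) (trans (cong suc (RowIns-cnt r i)) (sym (+-suc _ _))))
... | true  | false = trans (cong suc (RowIns-cnt r i)) (sym (+-suc _ _))
... | false | true  = trans (+-suc _ _) (cong suc (RowIns-cnt r i))
... | false | false = RowIns-cnt r i
RowIns-cnt (passes {x} {s} {a} {w} {t} {b} _ r) i with RowIns-cnt r i
... | ih with x ≤ᵇ i
...   | true  = cong suc ih
...   | false = ih

-- Tropical form of row insertion: with η, ξ, ω counting the letters ≤ i of the
-- new row, the old row and the word, η(i+1) = max(η(i), ξ(i+1)) + ω(i+1) - ω(i).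
RowIns-max : ∀ {s w t b} → RowIns s w t b → Sorted s → Sorted w → ∀ i →
  countLE (suc i) t + countLE i w ≡ (countLE i t ⊔ countLE (suc i) s) + countLE (suc i) w
RowIns-max {w = w} extend _ _ i =
  trans (+-comm (countLE (suc i) w) _) (cong (_+ countLE (suc i) w) (sym (⊔-identityʳ _)))
RowIns-max (done {x} {s}) _ _ i =
  cong (_+ 0) (sym (m≤n⇒m⊔n≡n (cnt-mono (n≤1+n i) (x ∷ s))))
RowIns-max (bumps {x} {s} {a} {w} {t} a<x r) (x≤s ∷ s↗) (a≤w ∷ w↗) i
  with RowIns-max r s↗ w↗ i | RowIns-All r (≤-All (<⇒≤ a<x) x≤s) a≤w | a ≤? i
... | ih | a≤t | yes a≤i
  rewrite cnt-≤ t (m≤n⇒m≤1+n a≤i) | cnt-≤ w a≤i | cnt-≤ t a≤i | cnt-≤ w (m≤n⇒m≤1+n a≤i)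
  with x ≤? suc i
...   | yes x≤1+i rewrite cnt-≤ s x≤1+i =
        cong suc (trans (+-suc _ _) (trans (cong suc ih) (sym (+-suc _ _))))
-- The old row has no letter ≤ i + 1, so its side of the maximum is 0.
...   | no  x≰1+i
        rewrite cnt-> s (≰⇒> x≰1+i) | cnt-zero (≤-All (≰⇒> x≰1+i) x≤s)
              | ⊔-identityʳ (countLE i t) =
        cong suc (trans (+-suc _ _) (trans (cong suc ih) (sym (+-suc _ _))))
-- If a > i, the bumped x exceeds i + 1. The counts at i of the new row and the word and the count
-- at i + 1 of the old row all vanish.
RowIns-max (bumps {x} {s} {a} {w} {t} a<x r) (x≤s ∷ s↗) (a≤w ∷ w↗) i
    | ih | a≤t | no a≰i
  rewrite cnt-> t (≰⇒> a≰i) | cnt-> w (≰⇒> a≰i)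
        | cnt-zero (≤-All (≰⇒> a≰i) a≤t) | cnt-zero (≤-All (≰⇒> a≰i) a≤w)
        | cnt-> s (≤-<-trans (≰⇒> a≰i) a<x) | cnt-zero (≤-All (≤-<-trans (≰⇒> a≰i) a<x) x≤s)
  with a ≤? suc i
...   | yes a≤1+i rewrite cnt-≤ t a≤1+i | cnt-≤ w a≤1+i = cong suc ih
...   | no  a≰1+i rewrite cnt-> t (≰⇒> a≰1+i) | cnt-> w (≰⇒> a≰1+i) = ih
RowIns-max (passes {x} {s} {a} {w} {t} x≤a r) (x≤s ∷ s↗) w↗@(a≤w ∷ _) i
  with RowIns-max r s↗ w↗ i | All._∷_ x≤a (≤-All x≤a a≤w) | x ≤? i
... | ih | x≤aw | yes x≤i rewrite cnt-≤ t (m≤n⇒m≤1+n x≤i) | cnt-≤ t x≤i | cnt-≤ s (m≤n⇒m≤1+n x≤i) =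
        cong suc ih
... | ih | x≤aw | no x≰i
  rewrite cnt-> t (≰⇒> x≰i) | cnt-zero (≤-All (≰⇒> x≰i) (RowIns-All r x≤s x≤aw))
        | cnt-zero (≤-All (≰⇒> x≰i) x≤aw)
  with x ≤? suc i
...   | yes x≤1+i rewrite cnt-≤ t x≤1+i | cnt-≤ s x≤1+i = cong suc ih
...   | no  x≰1+i rewrite cnt-> t (≰⇒> x≰1+i) | cnt-> s (≰⇒> x≰1+i) = ih

-- Column strictness and its effect on insertion

infix 4 _below_
-- A prefix relation lets the lower row be shorter, so that the shape condition and column
-- strictness are one statement.
_below_ : List ℕ → List ℕ → Set
_below_ = Prefix _>_

Tab : Tableau → Set
Tab []      = ⊤
Tab (s ∷ S) = Sorted s × rows S 0 below s × Tab S

Prefix-++⁻ˡ : ∀ {R : ℕ → ℕ → Set} {as bs cs ds} → length as ≡ length bs →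
  Prefix R (as ++ cs) (bs ++ ds) → Pointwise R as bs
Prefix-++⁻ˡ {as = []}    {[]}    _  _        = []
Prefix-++⁻ˡ {as = _ ∷ _} {_ ∷ _} eq (r ∷ rs) = r ∷ Prefix-++⁻ˡ (suc-injective eq) rs

Sorted-++⁻ʳ : ∀ xs {ys} → Sorted (xs ++ ys) → Sorted ys
Sorted-++⁻ʳ []       ys↗       = ys↗
Sorted-++⁻ʳ (_ ∷ xs) (_ ∷ ys↗) = Sorted-++⁻ʳ xs ys↗

Sorted-≤ : ∀ xs {e ys} → Sorted (xs ++ e ∷ ys) → All (_≤ e) xs
Sorted-≤ []       _         = []
Sorted-≤ (x ∷ xs) (x≤ ∷ s↗) = All.head (All.++⁻ʳ xs x≤) ∷ Sorted-≤ xs s↗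

Sorted-≥ : ∀ xs {e ys} → Sorted (xs ++ e ∷ ys) → All (e ≤_) ys
Sorted-≥ xs s↗ with e≤ ∷ _ ← Sorted-++⁻ʳ xs s↗ = e≤

Sorted-insert : ∀ xs {e ys} → Sorted (xs ++ ys) → All (_≤ e) xs → All (e ≤_) ys →
  Sorted (xs ++ e ∷ ys)
Sorted-insert []       s↗        _        e≤ = e≤ ∷ s↗
Sorted-insert (x ∷ xs) (x≤ ∷ s↗) (x≤e ∷ xs≤e) e≤ =
  All.++⁺ (All.++⁻ˡ xs x≤) (x≤e ∷ All.++⁻ʳ xs x≤) ∷ Sorted-insert xs s↗ xs≤e e≤

⊑-refl : ∀ {xs} → xs ⊑ xs
⊑-refl = Sub.refl refl

⊑-remove : ∀ xs {e ys} → (xs ++ ys) ⊑ (xs ++ e ∷ ys)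
⊑-remove xs = Sub.++⁺ (⊑-refl {xs}) (_ ∷ʳ ⊑-refl)

Pointwise->-≤ : ∀ {d v e} → Pointwise _>_ d v → All (_≤ e) d → All (_≤ e) v
Pointwise->-≤ []        []         = []
Pointwise->-≤ (r ∷ rs) (d≤ ∷ ds≤) = ≤-trans (<⇒≤ r) d≤ ∷ Pointwise->-≤ rs ds≤

below-remove : ∀ s₁ {s₂ e r} → s₂ below s₁ ++ e ∷ r → drop (length s₁) s₂ below r → s₂ below s₁ ++ r
below-remove []       _        q = q
below-remove (x ∷ s₁) []       q = []
below-remove (x ∷ s₁) (p ∷ ps) q = p ∷ below-remove s₁ ps q

-- Putting a smallest letter in front moves the sorted row one column to the right, so every column
-- gets a weakly smaller upper entry.
below-shift : ∀ {r w e} → Sorted w → All (e ≤_) w → r below w → r below e ∷ w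
below-shift _         _           []       = []
below-shift (y≤ ∷ w↗) (e≤y ∷ _) (p ∷ ps) = ≤-<-trans e≤y p ∷ below-shift w↗ y≤ ps

-- Columns within `r₁` meet an upper entry that has become weakly smaller; the column of `e₂` meets
-- `e`, or an entry that was below the last of `r₁` and so below `e₂`; further on both rows have
-- moved by one column and meet as before.
below-insert : ∀ r₁ {r₂ w e e₂} → Sorted w → All (e ≤_) w → e < e₂ → All (_≤ e₂) r₁ →
  r₁ ++ r₂ below w → r₁ ++ e₂ ∷ r₂ below e ∷ w
below-insert []       _         _          e<e₂ _         ps       = e<e₂ ∷ ps
below-insert (x ∷ r₁) (y≤ ∷ w↗) (e≤y ∷ _) _    (x≤ ∷ r₁≤) (p ∷ ps) =
  ≤-<-trans e≤y p ∷ below-insert r₁ w↗ y≤ (<-≤-trans p x≤) r₁≤ ps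

RowIns-[] : ∀ s → RowIns s [] s []
RowIns-[] []      = extend
RowIns-[] (x ∷ s) = done

-- The word w₁ is used up inside s₁ because s₁ matches each of its letters with a
-- larger one.
RowIns-++ : ∀ {s₁ w₁ r w₂ t b} → Sublist _<_ w₁ s₁ → All (λ x → All (x ≤_) w₂) s₁ →
  RowIns r w₂ t b → RowIns (s₁ ++ r) (w₁ ++ w₂) (newRow s₁ w₁ ++ t) (bumped s₁ w₁ ++ b)
RowIns-++ {[]} [] _ q = q
RowIns-++ {x ∷ s₁} {[]} {w₂ = []} _ _ q with refl , refl ← RowIns-functional q (RowIns-[] _) = done
RowIns-++ {x ∷ []} {[]} {w₂ = a ∷ w₂} _ ((x≤a ∷ _) ∷ _) q = passes x≤a q
RowIns-++ {x ∷ y ∷ s₁} {[]} {w₂ = a ∷ w₂} _ ((x≤a ∷ _) ∷ s₁≤) q =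
  passes x≤a (RowIns-++ {y ∷ s₁} (Sub.minimum _) s₁≤ q)
RowIns-++ {x ∷ s₁} {a ∷ w₁} m (x≤ ∷ s₁≤) q with a <? x
RowIns-++ {x ∷ s₁} {a ∷ w₁} m (x≤ ∷ s₁≤) q | yes a<x = bumps a<x (RowIns-++ (Sub.∷⁻ m) s₁≤ q)
RowIns-++ {x ∷ s₁} {a ∷ w₁} (a<x ∷ m) (x≤ ∷ s₁≤) q | no a≮x = contradiction a<x a≮x
RowIns-++ {x ∷ s₁} {a ∷ w₁} (x ∷ʳ m) (x≤ ∷ s₁≤) q | no a≮x =
  passes (≮⇒≥ a≮x) (RowIns-++ m s₁≤ q)

-- Each letter of the word bumps exactly the letter under it, so the word takes the place of the
-- whole row and the row is passed down. This is why inserting a row that fits amounts to stacking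
-- it.
below⇒RowIns : ∀ {r w} → r below w → RowIns r w w r
below⇒RowIns []       = extend
below⇒RowIns (p ∷ ps) = bumps p (below⇒RowIns ps)

below⇒RowIns-∷ : ∀ {e r w} → All (e ≤_) w → r below w → RowIns (e ∷ r) w (e ∷ w) r
below⇒RowIns-∷ []       []  = done
below⇒RowIns-∷ (e≤ ∷ _) ps = passes e≤ (below⇒RowIns ps)

insertWord-below : ∀ S {w} → Tab S → rows S 0 below w → ∀ j → insertWord (rows S) w j ≡ rows (w ∷ S) j
insertWord-below S _ b zero = RowIns⇒newRow (below⇒RowIns b)
insertWord-below [] {w} _ b (suc j) = sym (rows-[s] w (suc j))
insertWord-below (s ∷ S) {w} (_ , s′ , T) b (suc j) = begin
  insertWord (rows (s ∷ S)) w (suc j)  ≡⟨ insertWord-suc (rows (s ∷ S)) w j ⟩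
  insertWord (rows S) (bumped s w) j   ≡⟨ cong (λ b → insertWord (rows S) b j) (RowIns⇒bumped (below⇒RowIns b)) ⟩
  insertWord (rows S) s j              ≡⟨ insertWord-below S T s′ j ⟩
  rows (s ∷ S) j                       ∎
  where open ≡-Reasoning

-- Jeu de taquin

-- Slide c v S v⁺ S′: a hole in column c, with v to its right and the rows S below
-- it, leaves v⁺ from column c on and the rows S′.
data Slide : ℕ → List ℕ → Tableau → List ℕ → Tableau → Set where
  ends  : ∀ {c v S} → drop c (rows S 0) below v → Slide c v S v S
  drops : ∀ {c s₀ v₁ v₂ d₁ e d₂ S d₂⁺ S′} → length s₀ ≡ c → Pointwise _>_ d₁ v₁ → All (e ≤_) v₂ →
          Slide (length (s₀ ++ d₁)) d₂ S d₂⁺ S′ →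
          Slide c (v₁ ++ v₂) (((s₀ ++ d₁) ++ e ∷ d₂) ∷ S) (v₁ ++ e ∷ v₂) (((s₀ ++ d₁) ++ d₂⁺) ∷ S′)

-- The list d starts directly under the hole and v one column to its right, so the comparisons that
-- the hole makes are the column conditions of v moved one step left. In `at`, the hole runs past
-- `v₁` because the entries `d₁` under it were strictly larger, then drops into the place of e, ties
-- going down.
data Descent : List ℕ → List ℕ → Set where
  none : ∀ {v d} → d below v → Descent v d
  at   : ∀ {v₁ v₂ d₁ e d₂} → Pointwise _>_ d₁ v₁ → All (e ≤_) v₂ → Descent (v₁ ++ v₂) (d₁ ++ e ∷ d₂)

descent : ∀ v d → Sorted v → Descent v d
descent v       []      _  = none []
descent []      (b ∷ d) _  = at [] []
descent (a ∷ v) (b ∷ d) (a≤ ∷ v↗) with a <? b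
... | no a≮b = at [] (≮⇒≥ a≮b ∷ ≤-All (≮⇒≥ a≮b) a≤)
... | yes a<b with descent v d v↗
...   | none p = none (a<b ∷ p)
...   | at p q = at (a<b ∷ p) q

splitAt : ∀ c (s : List ℕ) → drop c s ≡ [] ⊎ ∃₂ λ s₀ d → s ≡ s₀ ++ d × length s₀ ≡ c
splitAt zero    s       = inj₂ ([] , s , refl , refl)
splitAt (suc c) []      = inj₁ refl
splitAt (suc c) (x ∷ s) with splitAt c s
... | inj₁ eq = inj₁ eq
... | inj₂ (s₀ , d , refl , refl) = inj₂ (x ∷ s₀ , d , refl , refl)

drop-length-++ : ∀ (xs : List ℕ) ys → drop (length xs) (xs ++ ys) ≡ ys
drop-length-++ []       ys = refl
drop-length-++ (x ∷ xs) ys = drop-length-++ xs ys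

++-∷-assoc : ∀ (xs ys : List ℕ) {z zs} → (xs ++ ys) ++ z ∷ zs ≡ (xs ++ ys ++ [ z ]) ++ zs
++-∷-assoc xs ys {z} {zs} =
  trans (sym (++-assoc (xs ++ ys) [ z ] zs)) (cong (_++ zs) (++-assoc xs ys [ z ]))

slideExists : ∀ c v S → Sorted v → Tab S → ∃₂ (Slide c v S)
slideExists c v [] v↗ _ = v , [] , ends (subst (_below v) (sym (drop-[] c)) [])
  where
  drop-[] : ∀ c → drop c (rows [] 0) ≡ []
  drop-[] zero    = refl
  drop-[] (suc c) = refl
slideExists c v (s ∷ S) v↗ (s↗ , _ , T) with splitAt c s
... | inj₁ eq = v , s ∷ S , ends (subst (_below v) (sym eq) [])
... | inj₂ (s₀ , d , refl , refl) with descent v d v↗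
...   | none p = v , _ , ends (subst (_below v) (sym (drop-length-++ s₀ d)) p)
...   | at {v₁} {v₂} {d₁} {e} {d₂} p q rewrite sym (++-assoc s₀ d₁ (e ∷ d₂))
        with _ , _ , sl ← slideExists (length (s₀ ++ d₁)) d₂ S (Sorted-++⁻ʳ (s₀ ++ d₁ ++ [ e ])
               (subst Sorted (++-∷-assoc s₀ d₁) s↗)) T
        = _ , _ , drops refl p q sl

insertWord-∷-cong : ∀ {s s′ w w′ S S′} → newRow s w ≡ newRow s′ w′ →
  (∀ j → insertWord (rows S) (bumped s w) j ≡ insertWord (rows S′) (bumped s′ w′) j) →
  ∀ j → insertWord (rows (s ∷ S)) w j ≡ insertWord (rows (s′ ∷ S′)) w′ j
insertWord-∷-cong eq eqs zero = eq
insertWord-∷-cong {s} {s′} {w} {w′} {S} {S′} eq eqs (suc j) =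
  trans (insertWord-suc (rows (s ∷ S)) w j) (trans (eqs j) (sym (insertWord-suc (rows (s′ ∷ S′)) w′ j)))

below⇒< : ∀ {e e₂ d₁ d₂ r} → Sorted (d₁ ++ e₂ ∷ d₂) → d₁ ++ e₂ ∷ d₂ below e ∷ r → e < e₂
below⇒< {d₁ = []} _ (p ∷ _) = p
below⇒< {d₁ = x ∷ d₁} (x≤ ∷ _) (p ∷ _) = <-≤-trans p (All.head (All.++⁻ʳ d₁ x≤))

-- A hole moving through a tableau takes the entry e out of its row; inserting e
-- along with the word, at the row it was taken from, gives the same tableau.
slide-insertWord : ∀ {c r S r⁺ S′} → Slide c r S r⁺ S′ → ∀ s₁ {e} w₁ {w₂} → length s₁ ≡ c →
  Tab ((s₁ ++ e ∷ r) ∷ S) → Sorted (w₁ ++ e ∷ w₂) → Sublist _<_ w₁ s₁ → r below w₂ →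
  Tab ((s₁ ++ r⁺) ∷ S′) × r⁺ below e ∷ w₂ ×
  (∀ j → insertWord (rows ((s₁ ++ e ∷ r) ∷ S)) (w₁ ++ w₂) j
       ≡ insertWord (rows ((s₁ ++ r⁺) ∷ S′)) (w₁ ++ e ∷ w₂) j)
slide-insertWord {r = r} {S} (ends stop) s₁ {e} w₁ {w₂} refl (s↗ , s>S , T) w↗ m r<w₂ =
  (⊑-Sorted (⊑-remove s₁) s↗ , below-remove s₁ s>S stop , T) , r<ew₂ ,
  insertWord-∷-cong (trans (RowIns⇒newRow ins₁) (sym (RowIns⇒newRow ins₂)))
    (λ j → cong (λ b → insertWord (rows S) b j) (trans (RowIns⇒bumped ins₁) (sym (RowIns⇒bumped ins₂))))
  where
  e≤w₂ = Sorted-≥ w₁ w↗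
  s₁≤e = Sorted-≤ s₁ s↗
  r<ew₂ : r below e ∷ w₂
  r<ew₂ with _ ∷ w₂↗ ← Sorted-++⁻ʳ w₁ w↗ = below-shift w₂↗ e≤w₂ r<w₂
  -- In both insertions `s₁` absorbs `w₁`. What remains is `w₂` into `e ∷ r`, or `e ∷ w₂` into `r`;
  -- either way the row becomes `e ∷ w₂` and `r` is bumped.
  ins₁ = RowIns-++ m (All.map (λ x≤e → ≤-All x≤e e≤w₂) s₁≤e) (below⇒RowIns-∷ e≤w₂ r<w₂)
  ins₂ = RowIns-++ m (All.map (λ x≤e → x≤e ∷ ≤-All x≤e e≤w₂) s₁≤e) (below⇒RowIns r<ew₂)
slide-insertWord (drops {s₀ = s₀} {r₁} {r₂} {d₁} {e₂} {d₂} {S} {d₂⁺} {S′} |s₀| d₁>r₁ e₂≤r₂ sl)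
  s₁ {e} w₁ {w₂} refl (s↗ , s>S , T@(s₂↗ , _)) w↗ m r<w₂ =
  (s⁺↗ , subst (_below s₁ ++ r₁ ++ e₂ ∷ r₂) (sym (++-assoc s₀ d₁ d₂⁺))
           (Prefix.++⁺ s₀>s₁ (Prefix.++⁺ d₁>r₁ d₂⁺<)) , T⁺) ,
  r⁺<ew₂ ,
  insertWord-∷-cong (trans (RowIns⇒newRow ins₁) (sym (RowIns⇒newRow ins₂))) (λ j → begin
    insertWord (rows (s₂ ∷ S)) (bumped (s₁ ++ e ∷ r₁ ++ r₂) (w₁ ++ w₂)) j
      ≡⟨ cong (λ b → insertWord (rows (s₂ ∷ S)) b j)
           (trans (RowIns⇒bumped ins₁) (sym (++-assoc b₁ r₁ r₂))) ⟩
    insertWord (rows (s₂ ∷ S)) ((b₁ ++ r₁) ++ r₂) j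
      ≡⟨ eqs j ⟩
    insertWord (rows (((s₀ ++ d₁) ++ d₂⁺) ∷ S′)) ((b₁ ++ r₁) ++ e₂ ∷ r₂) j
      ≡⟨ cong (λ b → insertWord (rows (((s₀ ++ d₁) ++ d₂⁺) ∷ S′)) b j)
           (trans (++-assoc b₁ r₁ (e₂ ∷ r₂)) (sym (RowIns⇒bumped ins₂))) ⟩
    insertWord (rows (((s₀ ++ d₁) ++ d₂⁺) ∷ S′)) (bumped (s₁ ++ r₁ ++ e₂ ∷ r₂) (w₁ ++ e ∷ w₂)) j ∎)
  where
  open ≡-Reasoning
  s₂ = (s₀ ++ d₁) ++ e₂ ∷ d₂
  b₁ = bumped s₁ w₁
  b₁⊑s₁ : b₁ ⊑ s₁
  b₁⊑s₁ = RowIns-⊑ (rowIns-graph s₁ w₁)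
  e≤w₂ = Sorted-≥ w₁ w↗
  s₁≤e = Sorted-≤ s₁ s↗
  s>S′ : s₀ ++ d₁ ++ e₂ ∷ d₂ below s₁ ++ e ∷ r₁ ++ r₂
  s>S′ = subst (_below _) (++-assoc s₀ d₁ (e₂ ∷ d₂)) s>S
  s₀>s₁ : Pointwise _>_ s₀ s₁
  s₀>s₁ = Prefix-++⁻ˡ |s₀| s>S′
  d<er : d₁ ++ e₂ ∷ d₂ below e ∷ r₁ ++ r₂
  d<er = Prefix.++⁻ {as = s₀} {bs = s₁} |s₀| s>S′
  d₁e₂↗ : Sorted (d₁ ++ e₂ ∷ d₂)
  d₁e₂↗ = Sorted-++⁻ʳ s₀ (subst Sorted (++-assoc s₀ d₁ (e₂ ∷ d₂)) s₂↗)
  e<e₂ : e < e₂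
  e<e₂ = below⇒< {d₁ = d₁} d₁e₂↗ d<er
  r₁≤e₂ : All (_≤ e₂) r₁
  r₁≤e₂ = Pointwise->-≤ d₁>r₁ (Sorted-≤ d₁ d₁e₂↗)
  -- `d₁ ++ [ e₂ ]` and `e ∷ r₁` have the same length, so what follows them is still aligned.
  d₂<r₂ : d₂ below r₂
  d₂<r₂ = Prefix.++⁻ {as = d₁ ++ [ e₂ ]} {bs = e ∷ r₁}
    (trans (length-++ d₁) (trans (+-comm (length d₁) 1) (cong suc (Pointwise.Pointwise-length d₁>r₁))))
    (subst (_below _) (sym (++-assoc d₁ [ e₂ ] d₂)) d<er)
  s⁺↗ : Sorted (s₁ ++ r₁ ++ e₂ ∷ r₂)
  s⁺↗ = subst Sorted (++-assoc s₁ r₁ (e₂ ∷ r₂))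
    (Sorted-insert (s₁ ++ r₁)
      (subst Sorted (sym (++-assoc s₁ r₁ r₂)) (⊑-Sorted (⊑-remove s₁) s↗))
      (All.++⁺ (All.map (λ x≤e → ≤-trans x≤e (<⇒≤ e<e₂)) s₁≤e) r₁≤e₂) e₂≤r₂)
  r⁺<ew₂ : r₁ ++ e₂ ∷ r₂ below e ∷ w₂
  r⁺<ew₂ with _ ∷ w₂↗ ← Sorted-++⁻ʳ w₁ w↗ = below-insert r₁ w₂↗ e≤w₂ e<e₂ r₁≤e₂ r<w₂
  ins₁ = RowIns-++ m (All.map (λ x≤e → ≤-All x≤e e≤w₂) s₁≤e) (below⇒RowIns-∷ e≤w₂ r<w₂)
  ins₂ = RowIns-++ m (All.map (λ x≤e → x≤e ∷ ≤-All x≤e e≤w₂) s₁≤e) (below⇒RowIns r⁺<ew₂)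
  -- The two insertions give the same row, and their bumped words differ only in `e₂`, the entry
  -- that the hole takes out of the next row. The matching needed for the induction hypothesis holds
  -- because `b₁` is a subword of `s₁`, entrywise smaller than `s₀`, and `r₁` is entrywise smaller
  -- than `d₁`.
  rec = slide-insertWord sl (s₀ ++ d₁) (b₁ ++ r₁) refl T
    (⊑-Sorted (Sub.++⁺ (Sub.++⁺ b₁⊑s₁ ⊑-refl) ⊑-refl)
      (subst Sorted (sym (++-assoc s₁ r₁ (e₂ ∷ r₂))) s⁺↗))
    (Sub.++⁺ (Sub.trans (λ { refl → id }) b₁⊑s₁ (Sub.fromPointwise (Pointwise.symmetric id s₀>s₁)))
             (Sub.fromPointwise (Pointwise.symmetric id d₁>r₁)))
    d₂<r₂
  T⁺ = proj₁ rec
  d₂⁺< = proj₁ (proj₂ rec)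
  eqs = proj₂ (proj₂ rec)

≥-refl : ∀ {v} → Prefix _≥_ v v
≥-refl {[]}    = []
≥-refl {x ∷ v} = ≤-refl ∷ ≥-refl

tail-≥ : ∀ {v} → Sorted v → Prefix _≥_ (drop 1 v) v
tail-≥ []       = []
tail-≥ (x≤ ∷ v↗) = go x≤ v↗
  where
  go : ∀ {x v} → All (x ≤_) v → Sorted v → Prefix _≥_ v (x ∷ v)
  go []        _         = []
  go (x≤y ∷ _) (y≤ ∷ v↗) = x≤y ∷ go y≤ v↗

insert-≥ : ∀ v₁ {y e v₂} → All (y ≤_) (v₁ ++ e ∷ v₂) → Sorted (v₁ ++ e ∷ v₂) →
  Prefix _≥_ (v₁ ++ e ∷ v₂) (y ∷ v₁ ++ v₂)
insert-≥ []       (y≤e ∷ _) _         = y≤e ∷ ≥-refl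
insert-≥ (x ∷ v₁) (y≤x ∷ _) (x≤ ∷ v↗) = y≤x ∷ insert-≥ v₁ x≤ v↗

-- When the hole drops, v gains the entry e that the row below loses: the situation of
-- `slide-insertWord` with `v₁` and `v₂` as the two parts of the word. Since `v⁺` starts one column
-- to the left of v, `drop 1 v⁺` and v occupy the same columns; entries there only grow, which keeps
-- the rows of U further up in place.
slide-row : ∀ {c v S v⁺ S′} → Slide c v S v⁺ S′ → Tab S → Sorted v → drop (suc c) (rows S 0) below v →
  Tab S′ × Sorted v⁺ × drop c (rows S′ 0) below v⁺ × Prefix _≥_ (drop 1 v⁺) v ×
  (∀ j → insertWord (rows S) v j ≡ insertWord (rows S′) v⁺ j)
slide-row (ends stop) T v↗ _ = T , v↗ , stop , tail-≥ v↗ , λ _ → refl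
slide-row (drops {s₀ = s₀} {v₁} {v₂} {d₁} {e} {d₂} {S} {d₂⁺} {S′} refl d₁>v₁ e≤v₂ sl) T@(s↗ , _) v↗ S<v =
  T⁺ , v⁺↗ ,
  subst (_below v₁ ++ e ∷ v₂)
    (sym (trans (cong (drop (length s₀)) (++-assoc s₀ d₁ d₂⁺)) (drop-length-++ s₀ (d₁ ++ d₂⁺))))
    (Prefix.++⁺ d₁>v₁ d₂⁺<) ,
  tail-row v₁ v⁺↗ , eqs
  where
  v⁺↗ : Sorted (v₁ ++ e ∷ v₂)
  v⁺↗ = Sorted-insert v₁ v↗
    (Pointwise->-≤ d₁>v₁ (All.++⁻ʳ s₀ (Sorted-≤ (s₀ ++ d₁) s↗))) e≤v₂
  tail-row : ∀ v₁ → Sorted (v₁ ++ e ∷ v₂) → Prefix _≥_ (drop 1 (v₁ ++ e ∷ v₂)) (v₁ ++ v₂)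
  tail-row []       _         = ≥-refl
  tail-row (x ∷ v₁) (x≤ ∷ v↗) = insert-≥ v₁ x≤ v↗
  drop-∷ : ∀ (q : List ℕ) {m} → m ≡ length q → drop (suc m) (q ++ e ∷ d₂) ≡ d₂
  drop-∷ []      refl = refl
  drop-∷ (x ∷ q) refl = drop-∷ q refl
  d₂<v₂ : d₂ below v₂
  d₂<v₂ = subst₂ _below_
    (trans (drop-drop (suc (length s₀)) (length v₁) ((s₀ ++ d₁) ++ e ∷ d₂))
      (drop-∷ (s₀ ++ d₁) (trans (cong (λ m → length s₀ + m) (sym (Pointwise.Pointwise-length d₁>v₁)))
                                (sym (length-++ s₀)))))
    (drop-length-++ v₁ v₂)
    (Prefix.drop⁺ (length v₁) S<v)
  rec = slide-insertWord sl (s₀ ++ d₁) v₁ refl T v⁺↗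
    (Sub.++ˡ s₀ (Sub.fromPointwise (Pointwise.symmetric id d₁>v₁))) d₂<v₂
  T⁺ = proj₁ rec
  d₂⁺< = proj₁ (proj₂ rec)
  eqs = proj₂ (proj₂ rec)

data Slides : ℕ → List ℕ → Tableau → List ℕ → Tableau → Set where
  []  : ∀ {v S} → Slides 0 v S v S
  _∷_ : ∀ {c v S v₁ S₁ v′ S′} → Slide c v S v₁ S₁ → Slides c v₁ S₁ v′ S′ → Slides (suc c) v S v′ S′

slidesExist : ∀ c v S → Sorted v → Tab S → drop c (rows S 0) below v → ∃₂ (Slides c v S)
slidesExist zero    v S _  _ _ = v , S , []
slidesExist (suc c) v S v↗ T p with slideExists c v S v↗ T
... | v₁ , S₁ , sl with slide-row sl T v↗ p
...   | T₁ , v₁↗ , p₁ , _ with slidesExist c v₁ S₁ v₁↗ T₁ p₁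
...     | v′ , S′ , sls = v′ , S′ , sl ∷ sls

slides-row : ∀ {c v S v′ S′} → Slides c v S v′ S′ → Tab S → Sorted v → drop c (rows S 0) below v →
  Tab (v′ ∷ S′) × Prefix _≥_ (drop c v′) v × (∀ j → insertWord (rows S) v j ≡ rows (v′ ∷ S′) j)
slides-row {v = v} {S} [] T v↗ p = (v↗ , p , T) , ≥-refl , insertWord-below S T p
slides-row {suc c} {v′ = v′} (sl ∷ sls) T v↗ p with slide-row sl T v↗ p
... | T₁ , v₁↗ , p₁ , v₁≥v , eq with slides-row sls T₁ v₁↗ p₁
...   | T′ , v′≥v₁ , eq′ =
  T′ ,
  subst (λ u → Prefix _≥_ u _) (trans (drop-drop c 1 v′) (cong (λ m → drop m v′) (+-comm c 1)))
    (Prefix.trans (λ p q → ≤-trans q p) (Prefix.drop⁺ 1 v′≥v₁) v₁≥v) ,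
  λ j → trans (eq j) (eq′ j)

-- Executing a slide on a grid

Cells : Set
Cells = List (Maybe ℕ)

cells : List ℕ → Cells
cells = map just

grid : Tableau → Grid
grid = map cells

-- A hole never moves up, so rows above it are untouched.
slide-∷ : ∀ k A g r c → slide k (A ∷ g) (suc r) c ≡ A ∷ slide k g r c
slide-∷ zero    A g r c = refl
slide-∷ (suc k) A g r c with getCell g (suc r) c | getCell g r (suc c)
... | nothing | nothing = refl
... | just b  | nothing = slide-∷ k A _ (suc r) c
... | nothing | just a  = slide-∷ k A _ r (suc c)
... | just b  | just a with b ≤ᵇ a
...   | true  = slide-∷ k A _ (suc r) c
...   | false = slide-∷ k A _ r (suc c)

slide-++ : ∀ k pre g c → slide k (pre ++ g) (length pre) c ≡ pre ++ slide k g 0 c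
slide-++ k []        g c = refl
slide-++ k (A ∷ pre) g c = trans (slide-∷ k A (pre ++ g) (length pre) c) (cong (A ∷_) (slide-++ k pre g c))

getRow-cells : ∀ c s → getRow (cells s) c ≡ head (drop c s)
getRow-cells zero    []      = refl
getRow-cells (suc c) []      = refl
getRow-cells zero    (x ∷ s) = refl
getRow-cells (suc c) (x ∷ s) = getRow-cells c s

getCell-grid : ∀ c S → getCell (grid S) 0 c ≡ head (drop c (rows S 0))
getCell-grid zero    []      = refl
getCell-grid (suc c) []      = refl
getCell-grid c       (s ∷ S) = getRow-cells c s

getRow-++ : ∀ (p : Cells) {h x} → getRow (p ++ h ∷ x) (suc (length p)) ≡ getRow x 0
getRow-++ []      {x = []}    = refl
getRow-++ []      {x = _ ∷ _} = refl
getRow-++ (_ ∷ p)             = getRow-++ p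

setRow-++ : ∀ (p : Cells) {h x v} → setRow (p ++ h ∷ x) (length p) v ≡ p ++ v ∷ x
setRow-++ []      = refl
setRow-++ (y ∷ p) = cong (y ∷_) (setRow-++ p)

setRow-++-suc : ∀ (p : Cells) {h y x v} → setRow (p ++ h ∷ y ∷ x) (suc (length p)) v ≡ p ++ h ∷ v ∷ x
setRow-++-suc []      = refl
setRow-++-suc (y ∷ p) = cong (y ∷_) (setRow-++-suc p)

takeRow-++ : ∀ (p : Cells) {x} → takeRow (p ++ x) (length p) ≡ p
takeRow-++ []      {[]}    = refl
takeRow-++ []      {_ ∷ _} = refl
takeRow-++ (y ∷ p)         = cong (y ∷_) (takeRow-++ p)

-- The column of the hole is the length of p. Its own content h is arbitrary: `slide` overwrites it
-- or cuts it off without reading it.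
holed : Cells → Maybe ℕ → List ℕ → Tableau → Grid
holed p h v S = (p ++ h ∷ cells v) ∷ grid S

length-∷ʳ : ∀ (p : Cells) {x} → length (p ++ [ x ]) ≡ suc (length p)
length-∷ʳ p = trans (length-++ p) (+-comm (length p) 1)

slide-stop : ∀ k g r c → getCell g (suc r) c ≡ nothing → getCell g r (suc c) ≡ nothing →
  slide (suc k) g r c ≡ truncCell g r c
slide-stop k g r c b a rewrite b | a = refl

slide-down : ∀ k g r c {b} → getCell g (suc r) c ≡ just b → Maybe.All (b ≤_) (getCell g r (suc c)) →
  slide (suc k) g r c ≡ slide k (setCell (setCell g r c (just b)) (suc r) c nothing) (suc r) c
slide-down k g r c b≡ b≤ rewrite b≡ with getCell g r (suc c) | b≤
... | nothing | _ = refl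
... | just a  | Maybe.just b≤a rewrite ≤ᵇ-true b≤a = refl

slide-right : ∀ k g r c {a} → Maybe.All (a <_) (getCell g (suc r) c) → getCell g r (suc c) ≡ just a →
  slide (suc k) g r c ≡ slide k (setCell (setCell g r c (just a)) r (suc c) nothing) r (suc c)
slide-right k g r c a< a≡ rewrite a≡ with getCell g (suc r) c | a<
... | nothing | _ = refl
... | just b  | Maybe.just a<b rewrite ≤ᵇ-false a<b = refl

holed-right : ∀ k p h a v S → Maybe.All (a <_) (head (drop (length p) (rows S 0))) →
  slide (suc k) (holed p h (a ∷ v) S) 0 (length p)
    ≡ slide k (holed (p ++ [ just a ]) nothing v S) 0 (length (p ++ [ just a ]))
holed-right k p h a v S a< = begin
  slide (suc k) (holed p h (a ∷ v) S) 0 (length p)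
    ≡⟨ slide-right k (holed p h (a ∷ v) S) 0 (length p) (subst (Maybe.All (a <_)) (sym (getCell-grid (length p) S)) a<)
         (getRow-++ p {h} {just a ∷ cells v}) ⟩
  slide k (setRow (setRow (p ++ h ∷ just a ∷ cells v) (length p) (just a)) (suc (length p)) nothing ∷ grid S)
    0 (suc (length p))
    ≡⟨ cong₂ (λ row c → slide k (row ∷ grid S) 0 c)
         (begin
           setRow (setRow (p ++ h ∷ just a ∷ cells v) (length p) (just a)) (suc (length p)) nothing
             ≡⟨ cong (λ row → setRow row (suc (length p)) nothing) (setRow-++ p) ⟩
           setRow (p ++ just a ∷ just a ∷ cells v) (suc (length p)) nothing
             ≡⟨ setRow-++-suc p ⟩
           p ++ just a ∷ nothing ∷ cells v
             ≡⟨ sym (++-assoc p [ just a ] (nothing ∷ cells v)) ⟩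
           (p ++ [ just a ]) ++ nothing ∷ cells v ∎)
         (sym (length-∷ʳ p)) ⟩
  slide k (holed (p ++ [ just a ]) nothing v S) 0 (length (p ++ [ just a ])) ∎
  where open ≡-Reasoning

holed-down : ∀ k p h v q b d S → length q ≡ length p → All (b ≤_) v →
  slide (suc k) (holed p h v ((q ++ b ∷ d) ∷ S)) 0 (length p)
    ≡ (p ++ cells (b ∷ v)) ∷ slide k (holed (cells q) nothing d S) 0 (length (cells q))
holed-down k p h v q b d S |q| b≤v = begin
  slide (suc k) (holed p h v ((q ++ b ∷ d) ∷ S)) 0 (length p)
    ≡⟨ slide-down k (holed p h v ((q ++ b ∷ d) ∷ S)) 0 (length p) cell
         (subst (Maybe.All (b ≤_)) (sym (getRow-++ p {h} {cells v})) (right b≤v)) ⟩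
  slide k (setRow (p ++ h ∷ cells v) (length p) (just b) ∷ setRow (cells (q ++ b ∷ d)) (length p) nothing ∷ grid S)
    1 (length p)
    ≡⟨ slide-∷ k _ _ 0 (length p) ⟩
  setRow (p ++ h ∷ cells v) (length p) (just b) ∷
    slide k (setRow (cells (q ++ b ∷ d)) (length p) nothing ∷ grid S) 0 (length p)
    ≡⟨ cong₂ _∷_ (setRow-++ p) (cong₂ (λ row c → slide k (row ∷ grid S) 0 c)
         (trans (cong₂ (λ row c → setRow row c nothing) (map-++ just q (b ∷ d)) (sym |cells-q|)) (setRow-++ (cells q)))
         (sym |cells-q|)) ⟩
  (p ++ cells (b ∷ v)) ∷ slide k (holed (cells q) nothing d S) 0 (length (cells q)) ∎
  where
  open ≡-Reasoning
  |cells-q| : length (cells q) ≡ length p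
  |cells-q| = trans (length-map just q) |q|
  cell : getRow (cells (q ++ b ∷ d)) (length p) ≡ just b
  cell = trans (getRow-cells (length p) (q ++ b ∷ d))
    (cong head (trans (cong (λ c → drop c (q ++ b ∷ d)) (sym |q|)) (drop-length-++ q (b ∷ d))))
  right : ∀ {v} → All (b ≤_) v → Maybe.All (b ≤_) (getRow (cells v) 0)
  right []        = Maybe.nothing
  right (b≤a ∷ _) = Maybe.just b≤a

-- Bounds the length of the path of a hole with v to its right and S below.
pathBound : List ℕ → Tableau → ℕ
pathBound v S = length v + sum (map (suc ∘ length) S)

drop-suc : ∀ c (s : List ℕ) → drop (suc c) s ≡ drop 1 (drop c s)
drop-suc zero    s       = refl
drop-suc (suc c) []      = refl
drop-suc (suc c) (x ∷ s) = drop-suc c s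

head-below : ∀ {d a v} → d below a ∷ v → Maybe.All (a <_) (head d)
head-below []      = Maybe.nothing
head-below (p ∷ _) = Maybe.just p

tail-below : ∀ {d a v} → d below a ∷ v → drop 1 d below v
tail-below []       = []
tail-below (_ ∷ ps) = ps

slide-ends : ∀ k p h v S → drop (length p) (rows S 0) below v → length v < k →
  slide k (holed p h v S) 0 (length p) ≡ (p ++ cells v) ∷ grid S
slide-ends (suc k) p h [] S stop _ =
  trans (slide-stop k (holed p h [] S) 0 (length p) (trans (getCell-grid (length p) S) (empty stop)) (getRow-++ p))
        (cong (_∷ grid S) (trans (takeRow-++ p) (sym (++-identityʳ p))))
  where
  empty : ∀ {d} → d below [] → head d ≡ nothing
  empty [] = refl
slide-ends (suc k) p h (a ∷ v) S stop (s≤s |v|<k) = begin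
  slide (suc k) (holed p h (a ∷ v) S) 0 (length p)
    ≡⟨ holed-right k p h a v S (head-below stop) ⟩
  slide k (holed (p ++ [ just a ]) nothing v S) 0 (length (p ++ [ just a ]))
    ≡⟨ slide-ends k (p ++ [ just a ]) nothing v S
         (subst (_below v)
           (sym (trans (cong (λ c → drop c (rows S 0)) (length-∷ʳ p)) (drop-suc (length p) (rows S 0))))
           (tail-below stop)) |v|<k ⟩
  ((p ++ [ just a ]) ++ cells v) ∷ grid S
    ≡⟨ cong (_∷ grid S) (++-assoc p [ just a ] (cells v)) ⟩
  (p ++ cells (a ∷ v)) ∷ grid S ∎
  where open ≡-Reasoning

head-drop : ∀ {c} s₀ {x : ℕ} {d} → length s₀ ≡ c → head (drop c (s₀ ++ x ∷ d)) ≡ just x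
head-drop s₀ {x} {d} refl = cong head (drop-length-++ s₀ (x ∷ d))

-- The fuel pays for one step to the right per entry of `v₁` and for one step down.
slide-drops : ∀ {v₁ v₂ d₁ e d₂ S} k p h s₀ → length s₀ ≡ length p → Pointwise _>_ d₁ v₁ → All (e ≤_) v₂ →
  slide (length v₁ + suc k) (holed p h (v₁ ++ v₂) (((s₀ ++ d₁) ++ e ∷ d₂) ∷ S)) 0 (length p)
    ≡ (p ++ cells (v₁ ++ e ∷ v₂)) ∷
      slide k (holed (cells (s₀ ++ d₁)) nothing d₂ S) 0 (length (cells (s₀ ++ d₁)))
slide-drops {e = e} {d₂} {S} k p h s₀ |s₀| [] e≤v₂ rewrite ++-identityʳ s₀ = holed-down k p h _ s₀ e d₂ S |s₀| e≤v₂
slide-drops {a ∷ v₁} {v₂} {b ∷ d₁} {e} {d₂} {S} k p h s₀ |s₀| (b>a ∷ d₁>v₁) e≤v₂ = begin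
  slide (suc (length v₁ + suc k)) (holed p h (a ∷ v₁ ++ v₂) (((s₀ ++ b ∷ d₁) ++ e ∷ d₂) ∷ S)) 0 (length p)
    ≡⟨ holed-right (length v₁ + suc k) p h a (v₁ ++ v₂) _
         (subst (Maybe.All (a <_))
           (sym (trans (cong (λ s → head (drop (length p) s)) (++-assoc s₀ (b ∷ d₁) (e ∷ d₂))) (head-drop s₀ |s₀|)))
           (Maybe.just b>a)) ⟩
  slide (length v₁ + suc k) (holed (p ++ [ just a ]) nothing (v₁ ++ v₂) (((s₀ ++ b ∷ d₁) ++ e ∷ d₂) ∷ S))
    0 (length (p ++ [ just a ]))
    ≡⟨ cong (λ s → slide (length v₁ + suc k) (holed (p ++ [ just a ]) nothing (v₁ ++ v₂) ((s ++ e ∷ d₂) ∷ S))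
         0 (length (p ++ [ just a ]))) (sym (++-assoc s₀ [ b ] d₁)) ⟩
  slide (length v₁ + suc k) (holed (p ++ [ just a ]) nothing (v₁ ++ v₂) ((((s₀ ++ [ b ]) ++ d₁) ++ e ∷ d₂) ∷ S))
    0 (length (p ++ [ just a ]))
    ≡⟨ slide-drops k (p ++ [ just a ]) nothing (s₀ ++ [ b ])
         (trans (length-++ s₀) (trans (cong (_+ 1) |s₀|) (sym (length-++ p)))) d₁>v₁ e≤v₂ ⟩
  ((p ++ [ just a ]) ++ cells (v₁ ++ e ∷ v₂)) ∷
    slide k (holed (cells ((s₀ ++ [ b ]) ++ d₁)) nothing d₂ S) 0 (length (cells ((s₀ ++ [ b ]) ++ d₁)))
    ≡⟨ cong₂ (λ row q → row ∷ slide k (holed (cells q) nothing d₂ S) 0 (length (cells q)))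
         (++-assoc p [ just a ] (cells (v₁ ++ e ∷ v₂))) (++-assoc s₀ [ b ] d₁) ⟩
  (p ++ cells (a ∷ v₁ ++ e ∷ v₂)) ∷
    slide k (holed (cells (s₀ ++ b ∷ d₁)) nothing d₂ S) 0 (length (cells (s₀ ++ b ∷ d₁))) ∎
  where open ≡-Reasoning

slide-grid : ∀ {c v S v⁺ S′} → Slide c v S v⁺ S′ → ∀ k p h → length p ≡ c → pathBound v S < k →
  slide k (holed p h v S) 0 c ≡ (p ++ cells v⁺) ∷ grid S′
slide-grid {v = v} {S} (ends stop) k p h refl bound =
  slide-ends k p h v S stop (≤-<-trans (m≤m+n (length v) _) bound)
slide-grid (drops {s₀ = s₀} {v₁} {v₂} {d₁} {e} {d₂} {S} {d₂⁺} {S′} |s₀| d₁>v₁ e≤v₂ sl) k p h refl bound = begin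
  slide k (holed p h (v₁ ++ v₂) (((s₀ ++ d₁) ++ e ∷ d₂) ∷ S)) 0 (length p)
    ≡⟨ cong (λ k → slide k (holed p h (v₁ ++ v₂) (((s₀ ++ d₁) ++ e ∷ d₂) ∷ S)) 0 (length p))
         (trans (sym (m+[n∸m]≡n |v₁|<k)) (sym (+-suc (length v₁) k′))) ⟩
  slide (length v₁ + suc k′) (holed p h (v₁ ++ v₂) (((s₀ ++ d₁) ++ e ∷ d₂) ∷ S)) 0 (length p)
    ≡⟨ slide-drops k′ p h s₀ |s₀| d₁>v₁ e≤v₂ ⟩
  (p ++ cells (v₁ ++ e ∷ v₂)) ∷ slide k′ (holed (cells (s₀ ++ d₁)) nothing d₂ S) 0 (length (cells (s₀ ++ d₁)))
    ≡⟨ cong (λ c → (p ++ cells (v₁ ++ e ∷ v₂)) ∷ slide k′ (holed (cells (s₀ ++ d₁)) nothing d₂ S) 0 c)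
         (length-map just (s₀ ++ d₁)) ⟩
  (p ++ cells (v₁ ++ e ∷ v₂)) ∷ slide k′ (holed (cells (s₀ ++ d₁)) nothing d₂ S) 0 (length (s₀ ++ d₁))
    ≡⟨ cong ((p ++ cells (v₁ ++ e ∷ v₂)) ∷_)
         (slide-grid sl k′ (cells (s₀ ++ d₁)) nothing (length-map just (s₀ ++ d₁)) bound′) ⟩
  (p ++ cells (v₁ ++ e ∷ v₂)) ∷ (cells (s₀ ++ d₁) ++ cells d₂⁺) ∷ grid S′
    ≡⟨ cong (λ row → (p ++ cells (v₁ ++ e ∷ v₂)) ∷ row ∷ grid S′) (sym (map-++ just (s₀ ++ d₁) d₂⁺)) ⟩
  (p ++ cells (v₁ ++ e ∷ v₂)) ∷ grid (((s₀ ++ d₁) ++ d₂⁺) ∷ S′) ∎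
  where
  open ≡-Reasoning
  k′ = k ∸ suc (length v₁)
  s  = (s₀ ++ d₁) ++ e ∷ d₂
  Σ  = sum (map (suc ∘ length) S)
  |v₁|<k : length v₁ < k
  |v₁|<k = ≤-<-trans (≤-trans (m≤m+n (length v₁) (length v₂)) (≤-trans (≤-reflexive (sym (length-++ v₁))) (m≤m+n _ _))) bound
  |d₂|≤|s| : length d₂ ≤ length s
  |d₂|≤|s| = ≤-trans (n≤1+n _) (≤-trans (m≤n+m _ (length (s₀ ++ d₁))) (≤-reflexive (sym (length-++ (s₀ ++ d₁)))))
  total : suc (length v₁) + suc (length d₂ + Σ) ≤ k
  total = ≤-trans (s≤s (+-mono-≤ (≤-trans (m≤m+n (length v₁) (length v₂)) (≤-reflexive (sym (length-++ v₁))))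
                                 (s≤s (+-monoˡ-≤ Σ |d₂|≤|s|)))) bound
  bound′ : length d₂ + Σ < k′
  bound′ = ≤-trans (≤-reflexive (sym (m+n∸m≡n (suc (length v₁)) _))) (∸-monoˡ-≤ (suc (length v₁)) total)

-- Corner search and full rectification

pad : ℕ → List ℕ → Cells
pad c v = replicate c nothing ++ cells v

offset-pad : ∀ c v → offset (pad c v) ≡ c
offset-pad zero    []      = refl
offset-pad zero    (_ ∷ _) = refl
offset-pad (suc c) v       = cong suc (offset-pad c v)

-- The loop inside findCorner is a local definition of Defs and has no name
-- here.  Abstracting its arguments in cornerLoop-unfold makes unification
-- recover it as the value of cornerLoop.
mutual
  cornerLoop : Grid → Grid → ℕ → Maybe (ℕ × ℕ) → Maybe (ℕ × ℕ)
  cornerLoop = _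

  cornerLoop-unfold : ∀ g → findCorner ([] ∷ g) ≡ findCorner ([] ∷ g)
  cornerLoop-unfold g with [] ∷ g | 1 | nothing {A = ℕ × ℕ}
  ... | g₀ | r | acc = refl {x = cornerLoop g₀ g r acc}

cornerLoop-grid : ∀ g₀ S r acc → cornerLoop g₀ (grid S) r acc ≡ acc
cornerLoop-grid g₀ []            r acc = refl
cornerLoop-grid g₀ ([] ∷ S)      r acc = cornerLoop-grid g₀ S (suc r) acc
cornerLoop-grid g₀ ((a ∷ s) ∷ S) r acc = cornerLoop-grid g₀ S (suc r) acc

-- The search keeps the last row with an inner cell, so the rows of `us` are overridden. This fixes
-- the order of the slides: a row of U reaches the left margin before the row above it starts to
-- move.
cornerLoop-corner : ∀ g₀ l c v S us r acc →
  cornerLoop g₀ (map (pad (suc l)) us ++ pad (suc c) v ∷ grid S) r acc ≡ just (r + length us , c)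
cornerLoop-corner g₀ l c v S [] r acc =
  trans (cornerLoop-grid g₀ S (suc r) _) (cong just (cong₂ _,_ (sym (+-identityʳ r)) (offset-pad c v)))
cornerLoop-corner g₀ l c v S (u ∷ us) r acc =
  trans (cornerLoop-corner g₀ l c v S us (suc r) _) (cong (λ r → just (r , c)) (sym (+-suc r (length us))))

rectifyGrid-grid : ∀ k S → rectifyGrid k (grid S) ≡ grid S
rectifyGrid-grid zero    S = refl
rectifyGrid-grid (suc k) S with findCorner (grid S) | cornerLoop-grid (grid S) S 0 nothing
... | _ | refl = refl

gridSize-++ : ∀ g g′ → gridSize (g ++ g′) ≡ gridSize g + gridSize g′
gridSize-++ []        g′ = refl
gridSize-++ (row ∷ g) g′ = cong suc (begin
  length (g ++ g′) + (length row + sum (map length (g ++ g′)))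
    ≡⟨ swap (length (g ++ g′)) (length row) (sum (map length (g ++ g′))) ⟩
  length row + gridSize (g ++ g′)
    ≡⟨ cong (λ m → length row + m) (gridSize-++ g g′) ⟩
  length row + (gridSize g + gridSize g′)
    ≡⟨ sym (+-assoc (length row) (gridSize g) (gridSize g′)) ⟩
  (length row + gridSize g) + gridSize g′
    ≡⟨ cong (_+ gridSize g′) (swap (length row) (length g) _) ⟩
  (length g + (length row + sum (map length g))) + gridSize g′ ∎)
  where
  open ≡-Reasoning
  swap : ∀ a b c → a + (b + c) ≡ b + (a + c)
  swap a b c = trans (sym (+-assoc a b c)) (trans (cong (_+ c) (+-comm a b)) (+-assoc b a c))

gridSize-grid : ∀ S → gridSize (grid S) ≡ sum (map (suc ∘ length) S)
gridSize-grid []      = refl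
gridSize-grid (s ∷ S) = trans (gridSize-++ (cells s ∷ []) (grid S))
  (cong₂ (λ a b → suc a + b) (trans (+-identityʳ _) (length-map just s)) (gridSize-grid S))

pathBound≤gridSize : ∀ pre c v S → pathBound v S ≤ gridSize (pre ++ pad c v ∷ grid S)
pathBound≤gridSize pre c v S = begin
  length v + sum (map (suc ∘ length) S)
    ≡⟨ cong₂ _+_ (sym (length-map just v)) (sym (gridSize-grid S)) ⟩
  length (cells v) + gridSize (grid S)
    ≤⟨ +-monoˡ-≤ _ (≤-trans (m≤n+m _ (length (replicate {A = Maybe ℕ} c nothing))) (≤-reflexive (sym (length-++ (replicate c nothing))))) ⟩
  length (pad c v) + gridSize (grid S)
    ≤⟨ +-monoˡ-≤ _ (≤-trans (n≤1+n _) (s≤s (m≤m+n (length (pad c v)) 0))) ⟩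
  gridSize (pad c v ∷ []) + gridSize (grid S)
    ≡⟨ sym (gridSize-++ (pad c v ∷ []) (grid S)) ⟩
  gridSize (pad c v ∷ grid S)
    ≤⟨ m≤n+m _ (gridSize pre) ⟩
  gridSize pre + gridSize (pad c v ∷ grid S)
    ≡⟨ sym (gridSize-++ pre _) ⟩
  gridSize (pre ++ pad c v ∷ grid S) ∎
  where open ≤-Reasoning

replicate-∷ʳ : ∀ c {x} (xs : Cells) → replicate (suc c) x ++ xs ≡ replicate c x ++ x ∷ xs
replicate-∷ʳ zero    xs = refl
replicate-∷ʳ (suc c) xs = cong (_ ∷_) (replicate-∷ʳ c xs)

rectifyGrid-slides : ∀ {c v S v′ S′} → Slides c v S v′ S′ → ∀ l us k → 
  rectifyGrid (c + k) (map (pad (suc l)) us ++ pad c v ∷ grid S)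
    ≡ rectifyGrid k (map (pad (suc l)) us ++ grid (v′ ∷ S′))
rectifyGrid-slides [] l us k = refl
rectifyGrid-slides {suc c} {v} {S} {v′} {S′} (_∷_ {v₁ = v₁} {S₁} sl sls) l us k
  with findCorner g | cornerLoop-corner g l c v S us 0 nothing
  where g = map (pad (suc l)) us ++ pad (suc c) v ∷ grid S
... | _ | refl = begin
  rectifyGrid (c + k) (slide (suc (gridSize g)) g (length us) c)
    ≡⟨ cong (λ r → rectifyGrid (c + k) (slide (suc (gridSize g)) g r c)) (sym (length-map (pad (suc l)) us)) ⟩
  rectifyGrid (c + k) (slide (suc (gridSize g)) g (length pre) c)
    ≡⟨ cong (rectifyGrid (c + k)) (slide-++ (suc (gridSize g)) pre (pad (suc c) v ∷ grid S) c) ⟩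
  rectifyGrid (c + k) (pre ++ slide (suc (gridSize g)) (pad (suc c) v ∷ grid S) 0 c)
    ≡⟨ cong (λ row → rectifyGrid (c + k) (pre ++ slide (suc (gridSize g)) (row ∷ grid S) 0 c)) (replicate-∷ʳ c (cells v)) ⟩
  rectifyGrid (c + k) (pre ++ slide (suc (gridSize g)) (holed (replicate c nothing) nothing v S) 0 c)
    ≡⟨ cong (λ g → rectifyGrid (c + k) (pre ++ g))
         (slide-grid sl (suc (gridSize g)) (replicate c nothing) nothing (length-replicate c)
           (s≤s (pathBound≤gridSize pre (suc c) v S))) ⟩
  rectifyGrid (c + k) (pre ++ pad c v₁ ∷ grid S₁)
    ≡⟨ rectifyGrid-slides sls l us k ⟩
  rectifyGrid k (pre ++ grid (v′ ∷ S′)) ∎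
  where
  open ≡-Reasoning
  pre = map (pad (suc l)) us
  g   = pre ++ pad (suc c) v ∷ grid S

-- Rectifies L U T R: the tableau R is obtained from T by placing the rows of U, from
-- last to first, L columns to the right on top and rectifying each in turn.
data Rectifies (L : ℕ) : Tableau → Tableau → Tableau → Set where
  []  : ∀ {T} → Rectifies L [] T T
  _∷_ : ∀ {u U T R v R′} → Slides L u R v R′ → Rectifies L U T R → Rectifies L (u ∷ U) T (v ∷ R′)

rectifyGrid-Rectifies : ∀ {l U T R} → Rectifies (suc l) U T R → ∀ pre k →
  rectifyGrid (length U * suc l + k) (map (pad (suc l)) pre ++ map (pad (suc l)) U ++ grid T)
    ≡ rectifyGrid k (map (pad (suc l)) pre ++ grid R)
rectifyGrid-Rectifies [] pre k = refl
rectifyGrid-Rectifies {l} {u ∷ U} {T} (_∷_ {R = R} sls rect) pre k = begin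
  rectifyGrid (suc l + length U * suc l + k) (map pd pre ++ pd u ∷ map pd U ++ grid T)
    ≡⟨ cong₂ rectifyGrid
         (trans (cong (_+ k) (+-comm (suc l) (length U * suc l))) (+-assoc (length U * suc l) (suc l) k))
         (trans (sym (++-assoc (map pd pre) [ pd u ] _)) (cong (_++ map pd U ++ grid T) (sym (map-++ pd pre [ u ])))) ⟩
  rectifyGrid (length U * suc l + (suc l + k)) (map pd (pre ++ [ u ]) ++ map pd U ++ grid T)
    ≡⟨ rectifyGrid-Rectifies rect (pre ++ [ u ]) (suc l + k) ⟩
  rectifyGrid (suc l + k) (map pd (pre ++ [ u ]) ++ grid R)
    ≡⟨ cong (rectifyGrid (suc l + k))
         (trans (cong (_++ grid R) (map-++ pd pre [ u ])) (++-assoc (map pd pre) [ pd u ] (grid R))) ⟩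
  rectifyGrid (suc l + k) (map pd pre ++ pd u ∷ grid R)
    ≡⟨ rectifyGrid-slides sls l pre k ⟩
  rectifyGrid k (map pd pre ++ grid (_ ∷ _)) ∎
  where
  open ≡-Reasoning
  pd = pad (suc l)

-- If the first row of T is empty, there are no inner cells and the grid is straight already. The
-- case stands apart because the corner search recognises the rows of U by a nonzero offset.
Rectifies-0 : ∀ {U T R} → Rectifies 0 U T R → map (pad 0) U ++ grid T ≡ grid R
Rectifies-0 []         = refl
Rectifies-0 ([] ∷ rect) = cong (_ ∷_) (Rectifies-0 rect)

catMaybes-cells : ∀ s → catMaybes (cells s) ≡ s
catMaybes-cells []      = refl
catMaybes-cells (x ∷ s) = cong (x ∷_) (catMaybes-cells s)

catMaybes-grid : ∀ S → map catMaybes (grid S) ≡ S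
catMaybes-grid []      = refl
catMaybes-grid (s ∷ S) = cong₂ _∷_ (catMaybes-cells s) (catMaybes-grid S)

-- Each slide uses up one inner cell, and inner cells are among those that `gridSize` counts; hence
-- the fuel of `J` suffices.
*≤gridSize : ∀ L U → length U * L ≤ gridSize (map (pad L) U)
*≤gridSize L []      = z≤n
*≤gridSize L (u ∷ U) = begin
  L + length U * L                       ≤⟨ +-mono-≤ L≤ (*≤gridSize L U) ⟩
  length (pad L u) + gridSize (map (pad L) U)
    ≤⟨ +-monoˡ-≤ (gridSize (map (pad L) U)) (≤-trans (m≤m+n (length (pad L u)) 0) (n≤1+n _)) ⟩
  gridSize (pad L u ∷ []) + gridSize (map (pad L) U)
    ≡⟨ sym (gridSize-++ (pad L u ∷ []) (map (pad L) U)) ⟩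
  gridSize (map (pad L) (u ∷ U)) ∎
  where
  open ≤-Reasoning
  L≤ : L ≤ length (pad L u)
  L≤ = ≤-trans (≤-reflexive (sym (length-replicate L)))
         (≤-trans (m≤m+n _ _) (≤-reflexive (sym (length-++ (replicate L nothing)))))

J-Rectifies : ∀ {U T R} → Rectifies (length (rowAt T 1)) U T R → J (star T U) ≡ R
J-Rectifies {U} {T} {R} rect = trans (cong (map catMaybes) (go (length (rowAt T 1)) rect)) (catMaybes-grid R)
  where
  open ≡-Reasoning
  go : ∀ L → Rectifies L U T R →
    rectifyGrid (gridSize (map (pad L) U ++ grid T)) (map (pad L) U ++ grid T) ≡ grid R
  go zero rect rewrite Rectifies-0 rect = rectifyGrid-grid (gridSize (grid R)) R
  go (suc l) rect = begin
    rectifyGrid (gridSize g) g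
      ≡⟨ cong (λ k → rectifyGrid k g) (sym (m+[n∸m]≡n fuel)) ⟩
    rectifyGrid (length U * suc l + (gridSize g ∸ length U * suc l)) g
      ≡⟨ rectifyGrid-Rectifies rect [] _ ⟩
    rectifyGrid (gridSize g ∸ length U * suc l) (grid R)
      ≡⟨ rectifyGrid-grid (gridSize g ∸ length U * suc l) R ⟩
    grid R ∎
    where
    g = map (pad (suc l)) U ++ grid T
    fuel : length U * suc l ≤ gridSize g
    fuel = ≤-trans (*≤gridSize (suc l) U)
      (≤-trans (m≤m+n _ (gridSize (grid T))) (≤-reflexive (sym (gridSize-++ (map (pad (suc l)) U) (grid T)))))

insertRows : Tableau → Rows → Rows
insertRows []      T = T
insertRows (u ∷ U) T = insertWord (insertRows U T) u

-- The clause over y carries the induction: from the original left edge of U on, the first row of R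
-- lies strictly below every row that the first row of U lay below, so the next row of U still fits.
-- T alone does not reach that column.
rectifies : ∀ U T → Tab U → Tab T →
  ∃ λ R → Rectifies (length (rowAt T 1)) U T R × Tab R ×
    (∀ {y} → rows U 0 below y → drop (length (rowAt T 1)) (rows R 0) below y) ×
    (∀ j → insertRows U (rows T) j ≡ rows R j)
rectifies [] T _ T▿ = T , [] , T▿ , (λ _ → subst (_below _) (sym (drop-all (rows T 0))) []) , λ _ → refl
  where
  drop-all : ∀ (s : List ℕ) → drop (length s) s ≡ []
  drop-all []      = refl
  drop-all (x ∷ s) = drop-all s
rectifies (u ∷ U) T (u↗ , U<u , U▿) T▿ with rectifies U T U▿ T▿
... | R , rect , R▿ , fits , eq with slidesExist (length (rowAt T 1)) u R u↗ R▿ (fits U<u)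
...   | v , R′ , sls with slides-row sls R▿ u↗ (fits U<u)
...     | R′▿ , v≥u , eq′ =
  v ∷ R′ , sls ∷ rect , R′▿ ,
  (λ u<y → Prefix.trans (λ p q → <-≤-trans q p) v≥u u<y) ,
  λ j → trans (insertWord-cong eq u j) (eq′ j)

rows-J : ∀ T U → Tab T → Tab U → ∀ j → rows (J (star T U)) j ≡ insertRows U (rows T) j
rows-J T U T▿ U▿ j with R , rect , _ , _ , eq ← rectifies U T U▿ T▿ =
  trans (cong (λ R → rows R j) (J-Rectifies rect)) (sym (eq j))

-- Gelfand-Tsetlin patterns, their tableaux, and hives

blocks : (ℕ → ℕ) → ℕ → ℕ → List ℕ
blocks m a zero    = []
blocks m a (suc l) = replicate (m a) a ++ blocks m (suc a) l

blocks-applyUpTo : ∀ m a l f → (∀ i → f i ≡ a + i) →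
  concatMap (λ i → replicate (m i) i) (applyUpTo f l) ≡ blocks m a l
blocks-applyUpTo m a zero    f f≡ = refl
blocks-applyUpTo m a (suc l) f f≡ = cong₂ _++_
  (cong (λ i → replicate (m i) i) (trans (f≡ 0) (+-identityʳ a)))
  (blocks-applyUpTo m (suc a) l (f ∘ suc) (λ i → trans (f≡ (suc i)) (+-suc a i)))

blocks-≥ : ∀ m a l → All (a ≤_) (blocks m a l)
blocks-≥ m a zero    = []
blocks-≥ m a (suc l) = All.++⁺ (All.replicate⁺ (m a) ≤-refl) (≤-All (n≤1+n a) (blocks-≥ m (suc a) l))

blocks-< : ∀ m a l → All (_< a + l) (blocks m a l)
blocks-< m a zero    = []
blocks-< m a (suc l) rewrite +-suc a l =
  All.++⁺ (All.replicate⁺ (m a) (s≤s (m≤m+n a l))) (blocks-< m (suc a) l)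

blocks-Sorted : ∀ m a l → Sorted (blocks m a l)
blocks-Sorted m a zero    = []
blocks-Sorted m a (suc l) = AllPairs.++⁺ (constant (m a)) (blocks-Sorted m (suc a) l)
  (All.replicate⁺ (m a) (≤-All (n≤1+n a) (blocks-≥ m (suc a) l)))
  where
  constant : ∀ k → Sorted (replicate k a)
  constant zero    = []
  constant (suc k) = All.replicate⁺ k ≤-refl ∷ constant k

cnt-replicate : ∀ {i x} k → x ≤ i → countLE i (replicate k x) ≡ k
cnt-replicate zero    x≤i = refl
cnt-replicate (suc k) x≤i = trans (cnt-≤ (replicate k _) x≤i) (cong suc (cnt-replicate k x≤i))

-- The multiplicities are successive differences of g, so the counts telescope.
blocks-cnt : ∀ m (g : ℕ → ℤ) a l d → d ≤ l →
  (∀ e → e < l → + m (suc a + e) ≡ g (suc a + e) ℤ.- g (a + e)) →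
  + countLE (a + d) (blocks m (suc a) l) ≡ g (a + d) ℤ.- g a
blocks-cnt m g a l zero _ _ rewrite +-identityʳ a =
  trans (cong +_ (cnt-zero (blocks-≥ m (suc a) l))) (sym (ℤ.+-inverseʳ (g a)))
blocks-cnt m g a (suc l) (suc d) (s≤s d≤l) eq rewrite +-suc a d = begin
  + countLE (suc a + d) (replicate (m (suc a)) (suc a) ++ blocks m (suc (suc a)) l)
    ≡⟨ cong +_ (trans (cnt-++ (suc a + d) (replicate (m (suc a)) (suc a)) _)
         (cong (_+ countLE (suc a + d) (blocks m (suc (suc a)) l)) (cnt-replicate (m (suc a)) (m≤m+n (suc a) d)))) ⟩
  + m (suc a) ℤ.+ + countLE (suc a + d) (blocks m (suc (suc a)) l)
    ≡⟨ cong₂ ℤ._+_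
         (subst₂ (λ x y → + m x ≡ g x ℤ.- g y) (+-identityʳ (suc a)) (+-identityʳ a) (eq 0 (s≤s z≤n)))
         (blocks-cnt m g (suc a) l d d≤l λ e e<l →
           subst₂ (λ x y → + m x ≡ g x ℤ.- g y) (+-suc (suc a) e) (+-suc a e) (eq (suc e) (s≤s e<l))) ⟩
  (g (suc a) ℤ.- g a) ℤ.+ (g (suc a + d) ℤ.- g (suc a))
    ≡⟨ telescope (g (suc a)) (g a) (g (suc a + d)) ⟩
  g (suc a + d) ℤ.- g a ∎
  where
  open ≡-Reasoning
  telescope : ∀ x y z → (x ℤ.- y) ℤ.+ (z ℤ.- x) ≡ z ℤ.- y
  telescope = solve-∀

-- Taking i + 1 to be the first letter of b shows that a starts with a smaller letter. Removing both
-- heads lowers both counts by one from there on, and for smaller i the count in b is 0.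
cnt⇒below : ∀ n {a b} → Sorted a → Sorted b → All (1 ≤_) b → All (_≤ n) b →
  (∀ i → i < n → countLE (suc i) b ≤ countLE i a) → b below a
cnt⇒below n {a} {[]} _ _ _ _ _ = []
cnt⇒below n {[]} {zero ∷ b} _ _ (() ∷ _) _ _
cnt⇒below n {[]} {suc y ∷ b} _ _ _ (y<n ∷ _) le with le y y<n
... | q rewrite cnt-≤ b (≤-refl {suc y}) with () ← q
cnt⇒below n {x ∷ a} {suc y ∷ b} (x≤ ∷ a↗) (y< ∷ b↗) (_ ∷ b≥1) (y<n ∷ b≤n) le = s≤s x≤y ∷
  cnt⇒below n a↗ b↗ b≥1 b≤n le′
  where
  x≤y : x ≤ y
  x≤y with x ≤? y
  ... | yes p = p
  ... | no x≰y with le y y<n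
  ...   | q rewrite cnt-≤ b (≤-refl {suc y}) | cnt-> a (≰⇒> x≰y) | cnt-zero (≤-All (≰⇒> x≰y) x≤) with () ← q
  le′ : ∀ i → i < n → countLE (suc i) b ≤ countLE i a
  le′ i i<n with y ≤? i
  ... | no y≰i rewrite cnt-zero (≤-All (s≤s (≰⇒> y≰i)) y<) = z≤n
  ... | yes y≤i with le i i<n
  ...   | q rewrite cnt-≤ b (s≤s y≤i) | cnt-≤ a (≤-trans x≤y y≤i) = s≤s⁻¹ q

Tab-rows : ∀ S → (∀ j → Sorted (rows S j)) → (∀ j → rows S (suc j) below rows S j) → Tab S
Tab-rows []      _  _  = tt
Tab-rows (s ∷ S) S↗ S< = S↗ 0 , S< 0 , Tab-rows S (S↗ ∘ suc) (S< ∘ suc)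

-- Writing i = suc r + e and j = suc r encodes j ≤ i without truncated subtraction.
record IsGT (n : ℕ) (G : ℕ → ℕ → ℤ) : Set where
  field
    nonneg : ∀ r e → suc r + e ≤ n → + 0 ℤ.≤ G (suc r + e) (suc r)
    mono   : ∀ r e → suc r + e < n → G (suc r + e) (suc r) ℤ.≤ G (suc (suc r + e)) (suc r)
    inter  : ∀ r e → suc r + e < n → G (suc (suc r + e)) (suc (suc r)) ℤ.≤ G (suc r + e) (suc r)

module GelfandTsetlin (n : ℕ) (G : ℕ → ℕ → ℤ) (gt : IsGT n G) where
  open IsGT gt

  -- `prev` and `mult` restate the local definitions of `gtRow`, with which they agree by
  -- computation.
  prev : ℕ → ℕ → ℤ
  prev j i = if i ≡ᵇ j then + 0 else G (i ∸ 1) j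

  mult : ℕ → ℕ → ℕ
  mult j i = ∣ G i j ℤ.- prev j i ∣

  prev-diag : ∀ j → prev j j ≡ + 0
  prev-diag zero = refl
  prev-diag (suc j) = prev-≡ᵇ j
    where
    ≡ᵇ-refl : ∀ j → (j ≡ᵇ j) ≡ true
    ≡ᵇ-refl zero = refl
    ≡ᵇ-refl (suc j) = ≡ᵇ-refl j
    prev-≡ᵇ : ∀ j → prev (suc j) (suc j) ≡ + 0
    prev-≡ᵇ j rewrite ≡ᵇ-refl j = refl

  prev-suc : ∀ j e → prev j (suc (j + e)) ≡ G (j + e) j
  prev-suc j e = cong (if_then + 0 else G (j + e) j) (≡ᵇ-false j e)
    where
    ≡ᵇ-false : ∀ j e → (suc (j + e) ≡ᵇ j) ≡ false
    ≡ᵇ-false zero    e = refl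
    ≡ᵇ-false (suc j) e = ≡ᵇ-false j e

  gtRow-blocks : ∀ r → r < n → gtRow n G (suc r) ≡ blocks (mult (suc r)) (suc r) (suc (n ∸ suc r))
  gtRow-blocks r r<n = trans
    (cong (λ l → concatMap (λ i → replicate (mult (suc r) i) i) (applyUpTo (λ i → suc r + i) l)) (+-∸-assoc 1 r<n))
    (blocks-applyUpTo (mult (suc r)) (suc r) (suc (n ∸ suc r)) (λ i → suc r + i) (λ _ → refl))

  T : Rows
  T = rows (gtTableau n G)

  private
    rows-applyUpTo : ∀ (f : ℕ → List ℕ) l r → r < l → rows (applyUpTo f l) r ≡ f r
    rows-applyUpTo f (suc l) zero    _         = refl
    rows-applyUpTo f (suc l) (suc r) (s≤s r<l) = rows-applyUpTo (f ∘ suc) l r r<l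

    rows-applyUpTo-≥ : ∀ (f : ℕ → List ℕ) l r → l ≤ r → rows (applyUpTo f l) r ≡ []
    rows-applyUpTo-≥ f zero    r       _         = refl
    rows-applyUpTo-≥ f (suc l) (suc r) (s≤s l≤r) = rows-applyUpTo-≥ (f ∘ suc) l r l≤r

  T-< : ∀ r → r < n → T r ≡ blocks (mult (suc r)) (suc r) (suc (n ∸ suc r))
  T-< r r<n = trans (cong (λ t → rows t r) (map-applyUpTo suc (gtRow n G) n))
    (trans (rows-applyUpTo (gtRow n G ∘ suc) n r r<n) (gtRow-blocks r r<n))

  T-≥ : ∀ r → n ≤ r → T r ≡ []
  T-≥ r n≤r = trans (cong (λ t → rows t r) (map-applyUpTo suc (gtRow n G) n))
    (rows-applyUpTo-≥ (gtRow n G ∘ suc) n r n≤r)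

  T-Sorted : ∀ r → Sorted (T r)
  T-Sorted r with r <? n
  ... | yes r<n rewrite T-< r r<n = blocks-Sorted (mult (suc r)) (suc r) (suc (n ∸ suc r))
  ... | no  r≮n rewrite T-≥ r (≮⇒≥ r≮n) = []

  T-≤n : ∀ r → All (_≤ n) (T r)
  T-≤n r with r <? n
  ... | no  r≮n rewrite T-≥ r (≮⇒≥ r≮n) = []
  ... | yes r<n rewrite T-< r r<n = All.map
    (λ {x} p → s≤s⁻¹ (subst (suc x ≤_) (trans (+-suc (suc r) _) (cong suc (m+[n∸m]≡n r<n))) p))
    (blocks-< (mult (suc r)) (suc r) (suc (n ∸ suc r)))

  T->r : ∀ r → All (r <_) (T r)
  T->r r with r <? n
  ... | no  r≮n rewrite T-≥ r (≮⇒≥ r≮n) = []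
  ... | yes r<n rewrite T-< r r<n = blocks-≥ (mult (suc r)) (suc r) (suc (n ∸ suc r))

  T-cnt-0 : ∀ r {i} → i ≤ r → countLE i (T r) ≡ 0
  T-cnt-0 r i≤r = cnt-zero (All.map (≤-<-trans i≤r) (T->r r))

  -- Nonnegativity on the diagonal and monotonicity in i make the absolute values in `mult`
  -- harmless. The first block, whose previous value is 0, is counted apart from the telescoping
  -- rest.
  T-cnt : ∀ r e → suc r + e ≤ n → + countLE (suc r + e) (T r) ≡ G (suc r + e) (suc r)
  T-cnt r e le rewrite T-< r (≤-trans (m≤m+n (suc r) e) le) = begin
    + countLE (suc r + e) (replicate (mult (suc r) (suc r)) (suc r) ++ blocks (mult (suc r)) (suc (suc r)) l)
      ≡⟨ cong +_ (trans (cnt-++ (suc r + e) (replicate (mult (suc r) (suc r)) (suc r)) _)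
           (cong (_+ countLE (suc r + e) (blocks (mult (suc r)) (suc (suc r)) l)) (cnt-replicate (mult (suc r) (suc r)) (m≤m+n (suc r) e)))) ⟩
    + mult (suc r) (suc r) ℤ.+ + countLE (suc r + e) (blocks (mult (suc r)) (suc (suc r)) l)
      ≡⟨ cong₂ ℤ._+_ mult-diag
           (blocks-cnt (mult (suc r)) (λ i → G i (suc r)) (suc r) l e e≤l λ d d<l → mult-suc d (bound d d<l)) ⟩
    G (suc r) (suc r) ℤ.+ (G (suc r + e) (suc r) ℤ.- G (suc r) (suc r))
      ≡⟨ cancel (G (suc r) (suc r)) (G (suc r + e) (suc r)) ⟩
    G (suc r + e) (suc r) ∎
    where
    open ≡-Reasoning
    l = n ∸ suc r
    r<n : r < n
    r<n = ≤-trans (m≤m+n (suc r) e) le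
    e≤l : e ≤ l
    e≤l = ≤-trans (≤-reflexive (sym (m+n∸m≡n (suc r) e))) (∸-monoˡ-≤ (suc r) le)
    bound : ∀ d → d < l → suc r + d < n
    bound d d<l = subst₂ _≤_ (+-suc (suc r) d) (m+[n∸m]≡n r<n) (+-monoʳ-≤ (suc r) d<l)
    cancel : ∀ x y → x ℤ.+ (y ℤ.- x) ≡ y
    cancel = solve-∀
    mult-diag : + mult (suc r) (suc r) ≡ G (suc r) (suc r)
    mult-diag rewrite prev-diag (suc r) | ℤ.+-identityʳ (G (suc r) (suc r)) =
      ℤ.0≤i⇒+∣i∣≡i (subst (λ i → + 0 ℤ.≤ G i (suc r)) (+-identityʳ (suc r))
        (nonneg r 0 (subst (_≤ n) (sym (+-identityʳ (suc r))) r<n)))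
    mult-suc : ∀ d → suc r + d < n →
      + mult (suc r) (suc (suc r) + d) ≡ G (suc (suc r) + d) (suc r) ℤ.- G (suc r + d) (suc r)
    mult-suc d p rewrite prev-suc (suc r) d = ℤ.0≤i⇒+∣i∣≡i (ℤ.i≤j⇒0≤j-i (mono r d p))

  T-below : ∀ r → T (suc r) below T r
  T-below r = cnt⇒below n (T-Sorted r) (T-Sorted (suc r))
    (All.map (≤-trans (s≤s z≤n)) (T->r (suc r))) (T-≤n (suc r)) le
    where
    le : ∀ i → i < n → countLE (suc i) (T (suc r)) ≤ countLE i (T r)
    le i i<n with suc r ≤? i
    ... | no r≮i rewrite T-cnt-0 (suc r) {suc i} (≰⇒> r≮i) = z≤n
    ... | yes r<i with e , refl ← m≤n⇒∃[o]m+o≡n r<i =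
      ℤ.drop‿+≤+ (subst₂ ℤ._≤_ (sym (T-cnt (suc r) e i<n)) (sym (T-cnt r e (<⇒≤ i<n))) (inter r e i<n))

  T-Tab : Tab (gtTableau n G)
  T-Tab = Tab-rows (gtTableau n G) T-Sorted T-below

hat-value : ∀ {n} (P : TriFun) r e z → suc r + e + z ≡ n →
  hat n P (suc r + e) (suc r) ≡ P e (suc r) z ℤ.- P (suc e) r z
hat-value P r e z refl rewrite m+n∸m≡n r e | m+n∸m≡n (r + e) z = refl

≤⇒∃ : ∀ {m n} → m ≤ n → ∃ λ z → m + z ≡ n
≤⇒∃ p = m≤n⇒∃[o]m+o≡n p

+-≤⇒-≤ : ∀ x y u v → x ℤ.+ y ℤ.≤ u ℤ.+ v → y ℤ.- u ℤ.≤ v ℤ.- x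
+-≤⇒-≤ x y u v le = subst₂ ℤ._≤_ (lhs x y u) (rhs x u v) (ℤ.+-monoˡ-≤ (ℤ.- (x ℤ.+ u)) le)
  where
  lhs : ∀ x y u → x ℤ.+ y ℤ.+ ℤ.- (x ℤ.+ u) ≡ y ℤ.- u
  lhs = solve-∀
  rhs : ∀ x u v → u ℤ.+ v ℤ.+ ℤ.- (x ℤ.+ u) ≡ v ℤ.- x
  rhs = solve-∀

-- Rhombus inequalities (i) and (ii) are the two halves of interlacing. Nonnegativity starts at i =
-- n, where the entries are the parts of `lam`, and spreads along G(i+1,j+1) ≤ G(i,j).
hive⇒IsGT : ∀ {n P} {lam : ℕ → ℕ} → IsHive n P →
  (∀ k → 1 ≤ k → k ≤ n → P (n ∸ k) k 0 ℤ.- P (suc (n ∸ k)) (k ∸ 1) 0 ≡ + lam k) → IsGT n (hat n P)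
hive⇒IsGT {n} {P} {lam} hive bdry = record { nonneg = nonneg ; mono = mono ; inter = inter }
  where
  open IsHive hive
  G = hat n P
  hive-sum : ∀ e r c → e + r + c + 2 ≡ suc (suc r + e) + c
  hive-sum = solveℕ
  mono : ∀ r e → suc r + e < n → G (suc r + e) (suc r) ℤ.≤ G (suc (suc r + e)) (suc r)
  mono r e p with z , refl ← ≤⇒∃ p
    rewrite hat-value {n} P r e (suc z) (+-suc (suc r + e) z)
          | cong (λ i → hat n P (suc i) (suc r)) (sym (+-suc r e))
          | hat-value {n} P r (suc e) z (cong (λ i → suc (i + z)) (+-suc r e)) =
    +-≤⇒-≤ (P (suc (suc e)) r z) (P e (suc r) (suc z)) (P (suc e) r (suc z)) (P (suc e) (suc r) z) (hive-i e r z (hive-sum e r z))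
  inter : ∀ r e → suc r + e < n → G (suc (suc r + e)) (suc (suc r)) ℤ.≤ G (suc r + e) (suc r)
  inter r e p with z , refl ← ≤⇒∃ p
    rewrite hat-value {n} P (suc r) e z refl | hat-value {n} P r e (suc z) (+-suc (suc r + e) z) =
    +-≤⇒-≤ (P (suc e) r (suc z)) (P e (suc (suc r)) z) (P (suc e) (suc r) z) (P e (suc r) (suc z))
      (subst₂ ℤ._≤_ (ℤ.+-comm (P e (suc (suc r)) z) (P (suc e) r (suc z)))
                    (ℤ.+-comm (P e (suc r) (suc z)) (P (suc e) (suc r) z))
      (hive-ii e r z (hive-sum e r z)))
  nonneg′ : ∀ z r e → suc r + e + z ≡ n → + 0 ℤ.≤ G (suc r + e) (suc r)
  nonneg′ zero r e eq rewrite +-identityʳ (r + e) with refl ← eq =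
    subst (+ 0 ℤ.≤_) (sym (trans (cong (λ z → P (r + e ∸ r) (suc r) z ℤ.- P (suc (r + e ∸ r)) r z) (n∸n≡0 (r + e)))
      (bdry (suc r) (s≤s z≤n) (m≤m+n (suc r) e)))) (ℤ.+≤+ z≤n)
  nonneg′ (suc z) r e eq = ℤ.≤-trans (nonneg′ z (suc r) e eq′)
    (inter r e (≤-trans (m≤m+n _ z) (≤-reflexive eq′)))
    where
    eq′ : suc (suc r) + e + z ≡ n
    eq′ = trans (sym (+-suc (suc r + e) z)) eq
  nonneg : ∀ r e → suc r + e ≤ n → + 0 ℤ.≤ G (suc r + e) (suc r)
  nonneg r e p with z , eq ← ≤⇒∃ p = nonneg′ z r e eq

-- Row insertion as the octahedron recurrence

-- A bumping letter is strictly smaller than the one it bumps, so the least possible letter of the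
-- word rises by one with each row.
RowIns-> : ∀ {p s w t b} → RowIns s w t b → All (p <_) w → All (suc p <_) b
RowIns-> extend _ = []
RowIns-> done _ = []
RowIns-> (bumps a<x r) (p<a ∷ p<w) = ≤-trans (s≤s p<a) a<x ∷ RowIns-> r p<w
RowIns-> (passes _ r) p<w = RowIns-> r p<w

RowIns-cnt-≤ : ∀ {p s w t b i} → RowIns s w t b → All (p <_) w → i ≤ p → countLE i t ≡ countLE i s
RowIns-cnt-≤ {s = s} {w} {t} {b} {i} r p<w i≤p = begin
  countLE i t               ≡⟨ sym (+-identityʳ _) ⟩
  countLE i t + 0           ≡⟨ cong (λ m → countLE i t + m) (sym (cnt-zero (All.map (≤-<-trans (m≤n⇒m≤1+n i≤p)) (RowIns-> r p<w)))) ⟩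
  countLE i t + countLE i b ≡⟨ RowIns-cnt r i ⟩
  countLE i s + countLE i w ≡⟨ cong (λ m → countLE i s + m) (cnt-zero (All.map (≤-<-trans i≤p) p<w)) ⟩
  countLE i s + 0           ≡⟨ +-identityʳ _ ⟩
  countLE i s               ∎
  where open ≡-Reasoning

-- Translation distributes over the maximum; this takes the maximum of two counts, each a difference
-- of values of f, to the maximum of two sums in the octahedron recurrence.
⊔-shift : ∀ a b c e → ((b ℤ.- e) ℤ.⊔ (c ℤ.- a)) ℤ.+ (a ℤ.+ e) ≡ (a ℤ.+ b) ℤ.⊔ (c ℤ.+ e)
⊔-shift a b c e = trans (ℤ.mono-≤-distrib-⊔ (ℤ.+-monoˡ-≤ (a ℤ.+ e)) (b ℤ.- e) (c ℤ.- a)) (cong₂ ℤ._⊔_ (left a b e) (right a c e))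
  where
  left : ∀ a b e → b ℤ.- e ℤ.+ (a ℤ.+ e) ≡ a ℤ.+ b
  left = solve-∀
  right : ∀ a c e → c ℤ.- a ℤ.+ (a ℤ.+ e) ≡ c ℤ.+ e
  right = solve-∀

-- The first two coordinates differ by |d - j| ≤ d + j, so at height d + j + 2 `octF` takes its
-- recursive branch.
dist-≤ : ∀ k j d → dist (suc (d + k)) (suc (j + k)) ≤ suc (d + j)
dist-≤ k j d = m≤n⇒m≤1+n (+-mono-≤ (≤-trans (≤-reflexive ([m+k]∸[n+k] d j)) (m∸n≤m d j))
                                   (≤-trans (≤-reflexive ([m+k]∸[n+k] j d)) (m∸n≤m j d)))
  where
  [m+k]∸[n+k] : ∀ m n → (m + k) ∸ (n + k) ≡ m ∸ n
  [m+k]∸[n+k] m n = trans (cong₂ _∸_ (+-comm m k) (+-comm n k)) ([m+n]∸[m+o]≡n∸o k m n)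

module Octahedron (n : ℕ) (M N : TriFun)
  (M≡N : ∀ k → k ≤ n → M k 0 (n ∸ k) ≡ N 0 k (n ∸ k)) where

  F : ℕ → ℕ → ℕ → ℤ
  F = octf n M N

  F-base : ∀ x y t → t ≤ dist x y → F x y t ≡ octBase n M N x y
  F-base x y zero          _ = refl
  F-base x y (suc zero)    _ = refl
  F-base x y (suc (suc t)) p rewrite ≤ᵇ-true p = refl

  F-M : ∀ x t → F x (x + t) t ≡ M x t (n ∸ (x + t))
  F-M x t rewrite F-base x (x + t) t (≤-trans (≤-reflexive (sym (m+n∸m≡n x t))) (m≤n+m (x + t ∸ x) (x ∸ (x + t))))
                | ≤ᵇ-true (m≤m+n x t) | m+n∸m≡n x t = refl

  F-N : ∀ y t → y + t ≤ n → F (y + t) y t ≡ N t y (n ∸ (y + t))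
  -- On the diagonal `octBase` reads M; the common edge of the two hives identifies this value with
  -- N.
  F-N y zero p rewrite +-identityʳ y | ≤ᵇ-true (≤-refl {y}) | n∸n≡0 y = M≡N y p
  F-N y (suc t) p rewrite F-base (y + suc t) y (suc t)
                            (≤-trans (≤-reflexive (sym (m+n∸m≡n y (suc t)))) (m≤m+n (y + suc t ∸ y) (y ∸ (y + suc t))))
                        | ≤ᵇ-false {y + suc t} {y} (m<m+n y (s≤s z≤n)) | m+n∸m≡n y (suc t) = refl

  F-octahedron : ∀ k j d → let x = suc (d + k) ; y = suc (j + k) ; t = suc (d + j) in
    F x y (suc t) ≡ ((F (suc x) y t ℤ.+ F (d + k) y t) ℤ.⊔ (F x (suc y) t ℤ.+ F x (j + k) t)) ℤ.- F x y (d + j)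
  F-octahedron k j d rewrite ≤ᵇ-false (s≤s (dist-≤ k j d)) = refl

  -- The intended values: η of J^k(i,j+1) for i = d+j+k+1; τ of J^k(i,j+1) for
  -- i = e+j+1 ≤ j+k, where J^k agrees with J^n; ω of the number of letters ≤ d+j+k+1
  -- bumped into row j+1 while row k+1 of U is inserted into J^(k+1).
  η : ℕ → ℕ → ℕ → ℤ
  η k j d = F (d + k) (suc (j + k)) (suc (d + j)) ℤ.- F (suc (d + k)) (j + k) (suc (d + j))

  τ : ℕ → ℕ → ℤ
  τ j e = F e (suc (e + j)) (suc j) ℤ.- F (suc e) (suc (e + j)) j

  ω : ℕ → ℕ → ℕ → ℤ
  ω k j d = F (suc (d + k)) (suc (j + k)) (d + j) ℤ.- F (suc (d + k)) (j + k) (suc (d + j))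

  -- Rows count from 0. `new` governs the letters above j + k, which the inserted words can affect;
  -- `old` those up to j + k, whose counts are still the ones given by M.
  record RowState (k j : ℕ) (s : List ℕ) : Set where
    field
      new   : ∀ d → suc (d + (j + k)) ≤ n → + countLE (suc (d + (j + k))) s ≡ η k j d
      old   : ∀ e → e < k → suc (e + j) ≤ n → + countLE (suc (e + j)) s ≡ τ j e
      above : All (j <_) s
      small : All (_≤ n) s
      inc   : Sorted s

  -- The bound j + k in `above` is the threshold: k for the row of U, and one more for each of the j
  -- rows passed.
  record WordState (k j : ℕ) (w : List ℕ) : Set where
    field
      count : ∀ d → suc (d + (j + k)) ≤ n → + countLE (suc (d + (j + k))) w ≡ ω k j d
      above : All (j + k <_) w
      small : All (_≤ n) w
      inc   : Sorted w

  module RowStep {k j s w t b} (S : RowState (suc k) j s) (W : WordState k j w) (r : RowIns s w t b) where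
    private
      module S = RowState S
      module W = WordState W

    -- j + k + 1 is the least letter that the arriving word can contain. The insertions so far have
    -- not changed its count in row j, so `old` applies with e = k.
    s-first : suc (j + k) ≤ n → + countLE (suc (j + k)) s ≡ F k (suc (j + k)) (suc j) ℤ.- F (suc k) (suc (j + k)) j
    s-first = subst (λ i → suc i ≤ n → + countLE (suc i) s ≡ F k (suc i) (suc j) ℤ.- F (suc k) (suc i) j)
      (+-comm k j) (S.old k ≤-refl)

    s-later : ∀ d → suc (suc (d + (j + k))) ≤ n → + countLE (suc (suc (d + (j + k)))) s ≡
      F (suc (d + k)) (suc (suc (j + k))) (suc (d + j)) ℤ.- F (suc (suc (d + k))) (suc (j + k)) (suc (d + j))
    s-later d with S.new d
    ... | new rewrite +-suc j k | +-suc d k | +-suc d (j + k) = new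

    max-ℤ : ∀ i → + countLE (suc i) t ℤ.+ + countLE i w ≡
      (+ countLE i t ℤ.⊔ + countLE (suc i) s) ℤ.+ + countLE (suc i) w
    max-ℤ i = cong +_ (RowIns-max r S.inc W.inc i)

    -- Induction on the letter. In the max recurrence the new row contributes `B - E` at i and the
    -- old row `C - A` at i + 1; adding `A + E` gives the maximum of the octahedron recurrence, with
    -- `G` as the value two layers down, while `H` is the second term of `η`.
    t-new : ∀ d → suc (d + (j + k)) ≤ n → + countLE (suc (d + (j + k))) t ≡ η k j d
    t-new zero p = begin
      + countLE (suc (j + k)) t
        ≡⟨ cong +_ (begin
             countLE (suc (j + k)) t
               ≡⟨ sym (trans (cong (λ m → countLE (suc (j + k)) t + m) (cnt-zero W.above)) (+-identityʳ _)) ⟩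
             countLE (suc (j + k)) t + countLE (j + k) w
               ≡⟨ RowIns-max r S.inc W.inc (j + k) ⟩
             (countLE (j + k) t ⊔ countLE (suc (j + k)) s) + countLE (suc (j + k)) w
               -- Up to j + k the insertion changes no count, so the maximum is attained by the old
               -- row and the recurrence starts from initial values.
               ≡⟨ cong (_+ countLE (suc (j + k)) w) (m≤n⇒m⊔n≡n
                    (≤-trans (≤-reflexive (RowIns-cnt-≤ r W.above ≤-refl)) (cnt-mono (n≤1+n (j + k)) s))) ⟩
             countLE (suc (j + k)) s + countLE (suc (j + k)) w ∎) ⟩
      + countLE (suc (j + k)) s ℤ.+ + countLE (suc (j + k)) w
        ≡⟨ cong₂ ℤ._+_ (s-first p) (W.count 0 p) ⟩
      (F k (suc (j + k)) (suc j) ℤ.- F (suc k) (suc (j + k)) j) ℤ.+ (F (suc k) (suc (j + k)) j ℤ.- F (suc k) (j + k) (suc j))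
        ≡⟨ telescope (F k (suc (j + k)) (suc j)) (F (suc k) (suc (j + k)) j) (F (suc k) (j + k) (suc j)) ⟩
      η k j 0 ∎
      where
      open ≡-Reasoning
      telescope : ∀ a b c → (a ℤ.- b) ℤ.+ (b ℤ.- c) ≡ a ℤ.- c
      telescope = solve-∀
    t-new (suc d) p = begin
      + countLE (suc i) t
        ≡⟨ solve-for (+ countLE (suc i) t) (+ countLE i w) (+ countLE i t ℤ.⊔ + countLE (suc i) s) (+ countLE (suc i) w) (max-ℤ i) ⟩
      (+ countLE i t ℤ.⊔ + countLE (suc i) s) ℤ.+ + countLE (suc i) w ℤ.- + countLE i w
        ≡⟨ cong₂ ℤ._-_ (cong₂ ℤ._+_ (cong₂ ℤ._⊔_ (t-new d p′) (s-later d p)) (W.count (suc d) p)) (W.count d p′) ⟩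
      ((B ℤ.- E) ℤ.⊔ (C ℤ.- A)) ℤ.+ (A ℤ.- H) ℤ.- (G ℤ.- E)
        ≡⟨ collect ((B ℤ.- E) ℤ.⊔ (C ℤ.- A)) A E G H ⟩
      (((B ℤ.- E) ℤ.⊔ (C ℤ.- A)) ℤ.+ (A ℤ.+ E)) ℤ.- G ℤ.- H
        ≡⟨ cong (λ m → m ℤ.- G ℤ.- H) (⊔-shift A B C E) ⟩
      ((A ℤ.+ B) ℤ.⊔ (C ℤ.+ E)) ℤ.- G ℤ.- H
        ≡⟨ cong (ℤ._- H) (sym (F-octahedron k j d)) ⟩
      η k j (suc d) ∎
      where
      open ≡-Reasoning
      i = suc (d + (j + k))
      A = F (suc (suc (d + k))) (suc (j + k)) (suc (d + j))
      B = F (d + k) (suc (j + k)) (suc (d + j))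
      C = F (suc (d + k)) (suc (suc (j + k))) (suc (d + j))
      E = F (suc (d + k)) (j + k) (suc (d + j))
      G = F (suc (d + k)) (suc (j + k)) (d + j)
      H = F (suc (suc (d + k))) (j + k) (suc (suc (d + j)))
      p′ : i ≤ n
      p′ = <⇒≤ p
      solve-for : ∀ a b c d → a ℤ.+ b ≡ c ℤ.+ d → a ≡ c ℤ.+ d ℤ.- b
      solve-for a b c d eq = trans (cancel a b) (cong (ℤ._- b) eq)
        where
        cancel : ∀ a b → a ≡ a ℤ.+ b ℤ.- b
        cancel = solve-∀
      collect : ∀ m a e g h → m ℤ.+ (a ℤ.- h) ℤ.- (g ℤ.- e) ≡ (m ℤ.+ (a ℤ.+ e)) ℤ.- g ℤ.- h
      collect = solve-∀

    t-state : RowState k j t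
    t-state = record
      { new   = t-new
      ; old   = λ e e<k p → trans (cong +_ (RowIns-cnt-≤ r W.above (≤-trans (s≤s (≤-reflexive (+-comm e j))) (+-monoʳ-< j e<k))))
                                  (S.old e (m<n⇒m<1+n e<k) p)
      ; above = RowIns-All r S.above (All.map (≤-<-trans (m≤m+n j k)) W.above)
      ; small = RowIns-All r S.small W.small
      ; inc   = RowIns-Sorted r S.inc W.inc
      }

    -- Conservation of letters gives the bumped word from the row just computed. The range starts at
    -- j + k + 2 because no smaller letter can be bumped.
    b-count : ∀ d → suc (suc (d + (j + k))) ≤ n → + countLE (suc (suc (d + (j + k)))) b ≡
      F (suc (d + k)) (suc (suc (j + k))) (suc (d + j)) ℤ.- F (suc (d + k)) (suc (j + k)) (suc (suc (d + j)))
    b-count d p = begin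
      + countLE i b
        ≡⟨ solve-for (+ countLE i t) (+ countLE i b) (+ countLE i s) (+ countLE i w) (cong +_ (RowIns-cnt r i)) ⟩
      + countLE i s ℤ.+ + countLE i w ℤ.- + countLE i t
        ≡⟨ cong₂ ℤ._-_ (cong₂ ℤ._+_ (s-later d p) (W.count (suc d) p)) (t-new (suc d) p) ⟩
      (C ℤ.- A) ℤ.+ (A ℤ.- H) ℤ.- (X ℤ.- H)
        ≡⟨ telescope C A H X ⟩
      C ℤ.- X ∎
      where
      open ≡-Reasoning
      i = suc (suc (d + (j + k)))
      A = F (suc (suc (d + k))) (suc (j + k)) (suc (d + j))
      C = F (suc (d + k)) (suc (suc (j + k))) (suc (d + j))
      H = F (suc (suc (d + k))) (j + k) (suc (suc (d + j)))
      X = F (suc (d + k)) (suc (j + k)) (suc (suc (d + j)))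
      telescope : ∀ c a h x → (c ℤ.- a) ℤ.+ (a ℤ.- h) ℤ.- (x ℤ.- h) ≡ c ℤ.- x
      telescope = solve-∀
      solve-for : ∀ a b c d → a ℤ.+ b ≡ c ℤ.+ d → b ≡ c ℤ.+ d ℤ.- a
      solve-for a b c d eq = trans (cancel a b) (cong (ℤ._- a) eq)
        where
        cancel : ∀ a b → b ≡ a ℤ.+ b ℤ.- a
        cancel = solve-∀

    b-state : WordState k (suc j) b
    b-state = record
      { count = count
      ; above = RowIns-> r W.above
      ; small = ⊑-All (RowIns-⊑ r) S.small
      ; inc   = ⊑-Sorted (RowIns-⊑ r) S.inc
      }
      where
      count : ∀ d → suc (d + suc (j + k)) ≤ n → + countLE (suc (d + suc (j + k))) b ≡ ω k (suc j) d
      count d p rewrite +-suc d (j + k) | +-suc d j = b-count d p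

  State : ℕ → Rows → Set
  State k S = ∀ j → RowState k j (S j)

  wordInto-state : ∀ {k S w} → State (suc k) S → WordState k 0 w → ∀ j → WordState k j (wordInto S w j)
  wordInto-state S W zero    = W
  wordInto-state S W (suc j) = RowStep.b-state (S j) (wordInto-state S W j) (rowIns-graph _ _)

  insertWord-state : ∀ {k S w} → State (suc k) S → WordState k 0 w → State k (insertWord S w)
  insertWord-state S W j = RowStep.t-state (S j) (wordInto-state S W j) (rowIns-graph _ _)

  -- Tail sums of row lengths

  tailSum-∷ : ∀ t r → tailSum t (suc r) ≡ length (rows t r) + tailSum t (suc (suc r))
  tailSum-∷ []      zero    = refl
  tailSum-∷ []      (suc r) = refl
  tailSum-∷ (s ∷ t) zero    = refl
  tailSum-∷ (s ∷ t) (suc r) = tailSum-∷ t r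

  tailSum-empty : ∀ t r → (∀ r′ → r ≤ r′ → rows t r′ ≡ []) → tailSum t (suc r) ≡ 0
  tailSum-empty []      zero    _     = refl
  tailSum-empty []      (suc r) _     = refl
  tailSum-empty (s ∷ t) zero    empty = cong₂ _+_ (cong length (empty 0 z≤n))
    (tailSum-empty t 0 (λ r′ _ → empty (suc r′) z≤n))
  tailSum-empty (s ∷ t) (suc r) empty = tailSum-empty t r (λ r′ r≤r′ → empty (suc r′) (s≤s r≤r′))

  module TailSums {k t} (S : State k (rows t)) where
    private module S j = RowState (S j)

    empty : ∀ r → n ≤ r → rows t r ≡ []
    empty r n≤r with rows t r | S.above r | S.small r
    ... | []    | _       | _       = refl
    ... | x ∷ _ | r<x ∷ _ | x≤n ∷ _ = contradiction (≤-trans x≤n n≤r) (<⇒≱ r<x)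

    private
      step : ∀ r a b c → + length (rows t r) ≡ b ℤ.- c → + tailSum t (suc (suc r)) ≡ a ℤ.- b →
        + tailSum t (suc r) ≡ a ℤ.- c
      step r a b c eq eq′ = trans (cong +_ (tailSum-∷ t r)) (trans (cong₂ ℤ._+_ eq eq′) (telescope a b c))
        where
        telescope : ∀ a b c → (b ℤ.- c) ℤ.+ (a ℤ.- b) ≡ a ℤ.- c
        telescope = solve-∀

    length-row : ∀ r → + length (rows t r) ≡ + countLE n (rows t r)
    length-row r = cong +_ (sym (cnt-length (S.small r)))

    -- Row lengths are counts of letters ≤ n, hence differences of neighbouring values of f on the
    -- face of P. The sum starts from the bottom at the corner `F 0 n n`, in the rows that the
    -- insertions have left unchanged.
    tailSum-old : ∀ e r → e + r ≡ n → e ≤ k → + tailSum t (suc r) ≡ F 0 n n ℤ.- F e n r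
    tailSum-old zero r refl _ = trans (cong +_ (tailSum-empty t r empty)) (sym (ℤ.+-inverseʳ (F 0 n n)))
    tailSum-old (suc e) r eq e<k = step r (F 0 n n) (F e n (suc r)) (F (suc e) n r)
      (trans (length-row r)
        (subst (λ i → + countLE i (rows t r) ≡ F e i (suc r) ℤ.- F (suc e) i r) eq
          (S.old r e e<k (≤-reflexive eq))))
      (tailSum-old e (suc r) (trans (+-suc e r) eq) (<⇒≤ e<k))

    tailSum-new : ∀ d r → d + (r + k) ≡ n → + tailSum t (suc r) ≡ F 0 n n ℤ.- F (d + k) (r + k) (d + r)
    -- Row n - k is the topmost one whose letters up to n all lie in the unchanged range; the two
    -- telescoping sums meet here.
    tailSum-new zero r eq = trans (tailSum-old k r (trans (+-comm k r) eq) ≤-refl)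
      (cong (λ y → F 0 n n ℤ.- F k y r) (sym eq))
    tailSum-new (suc d) r eq = step r (F 0 n n) (F (d + k) (suc (r + k)) (suc (d + r))) (F (suc (d + k)) (r + k) (suc (d + r)))
      (trans (length-row r)
        (trans (cong (λ i → + countLE i (rows t r)) (sym eq)) (S.new r d (≤-reflexive eq))))
      (trans (tailSum-new d (suc r) (trans (+-suc d (r + k)) eq))
        (cong (λ t → F 0 n n ℤ.- F (d + k) (suc (r + k)) t) (+-suc d r)))

  -- The two tableaux of the theorem

  module _ (gtM : IsGT n (hat n M)) (gtN : IsGT n (hat n N)) where
    private
      TM = gtTableau n (hat n M)
      TN = gtTableau n (hat n N)
      module GM = GelfandTsetlin n (hat n M) gtM
      module GN = GelfandTsetlin n (hat n N) gtN

    state-M : State n (rows TM)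
    state-M j = record
      -- At k = n the letters concerned exceed n, so this field is vacuous: the whole of T is
      -- initial data.
      { new   = λ d p → contradiction (≤-trans (s≤s (≤-trans (m≤n+m n j) (m≤n+m (j + n) d))) p) (<-irrefl refl)
      ; old   = λ e _ p → old e p
      ; above = GM.T->r j
      ; small = GM.T-≤n j
      ; inc   = GM.T-Sorted j
      }
      where
      old : ∀ e → suc (e + j) ≤ n → + countLE (suc (e + j)) (rows TM j) ≡ τ j e
      old e p = begin
        + countLE (suc (e + j)) (rows TM j)   ≡⟨ cong (λ i → + countLE (suc i) (rows TM j)) (+-comm e j) ⟩
        + countLE (suc j + e) (rows TM j)     ≡⟨ GM.T-cnt j e p′ ⟩
        hat n M (suc j + e) (suc j)           ≡⟨ hat-value M j e z (m+[n∸m]≡n p′) ⟩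
        M e (suc j) z ℤ.- M (suc e) j z       ≡⟨ cong₂ ℤ._-_ (sym first) (sym second) ⟩
        τ j e                                 ∎
        where
        open ≡-Reasoning
        p′ : suc j + e ≤ n
        p′ = subst (λ i → suc i ≤ n) (+-comm e j) p
        z  = n ∸ (suc j + e)
        first : F e (suc (e + j)) (suc j) ≡ M e (suc j) z
        first = trans (cong (λ y → F e y (suc j)) (sym (+-suc e j)))
          (trans (F-M e (suc j)) (cong (λ i → M e (suc j) (n ∸ i)) (+-comm e (suc j))))
        second : F (suc e) (suc (e + j)) j ≡ M (suc e) j z
        second = trans (F-M (suc e) j) (cong (λ i → M (suc e) j (n ∸ suc i)) (+-comm e j))

    word-N : ∀ k → WordState k 0 (rows TN k)
    word-N k = record
      { count = count
      ; above = GN.T->r k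
      ; small = GN.T-≤n k
      ; inc   = GN.T-Sorted k
      }
      where
      count : ∀ d → suc (d + k) ≤ n → + countLE (suc (d + k)) (rows TN k) ≡ ω k 0 d
      count d p = begin
        + countLE (suc (d + k)) (rows TN k)   ≡⟨ cong (λ i → + countLE (suc i) (rows TN k)) (+-comm d k) ⟩
        + countLE (suc k + d) (rows TN k)     ≡⟨ GN.T-cnt k d p′ ⟩
        hat n N (suc k + d) (suc k)           ≡⟨ hat-value N k d z (m+[n∸m]≡n p′) ⟩
        N d (suc k) z ℤ.- N (suc d) k z       ≡⟨ cong₂ ℤ._-_ (sym first) (sym second) ⟩
        ω k 0 d                               ∎
        where
        open ≡-Reasoning
        p′ : suc k + d ≤ n
        p′ = subst (λ i → suc i ≤ n) (+-comm d k) p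
        z  = n ∸ (suc k + d)
        first : F (suc (d + k)) (suc k) (d + 0) ≡ N d (suc k) z
        first = trans (cong₂ (λ x t → F (suc x) (suc k) t) (+-comm d k) (+-identityʳ d)) (F-N (suc k) d p′)
        second : F (suc (d + k)) k (suc (d + 0)) ≡ N (suc d) k z
        second = trans (cong₂ (λ x t → F x k (suc t)) (trans (cong suc (+-comm d k)) (sym (+-suc k d))) (+-identityʳ d))
          (trans (F-N k (suc d) (subst (_≤ n) (sym (+-suc k d)) p′)) (cong (λ i → N (suc d) k (n ∸ i)) (+-suc k d)))

    Jm-state : ∀ m {k} → m + k ≡ n → State k (rows (Jm n TM TN m))
    Jm-state zero    refl = state-M
    Jm-state (suc m) {k} eq j = subst (RowState k j)
      (sym (trans (cong (λ r → rows (insertList (Jm n TM TN m) (rowAt TN r)) j) n∸m≡)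
        (rows-insertList (Jm n TM TN m) (rows TN k) (λ j → RowState.inc (ih j)) (GN.T-Sorted k) j)))
      (insertWord-state ih (word-N k) j)
      where
      ih : State (suc k) (rows (Jm n TM TN m))
      ih = Jm-state m (trans (+-suc m k) eq)
      n∸m≡ : n ∸ m ≡ suc k
      n∸m≡ = trans (cong (_∸ m) (sym (trans (+-suc m k) eq))) (m+n∸m≡n m (suc k))

    -- U stands for the rows of the tableau of N from index k on. The recursion raises k to n, where
    -- nothing has been inserted yet.
    insertRows-state : ∀ U {k} → k + length U ≡ n → (∀ r → rows U r ≡ rows TN (k + r)) →
      State k (insertRows U (rows TM))
    insertRows-state []      {k} eq _ rewrite +-identityʳ k | eq = state-M
    insertRows-state (u ∷ U) {k} eq U≡ = insertWord-state
      (insertRows-state U (trans (sym (+-suc k (length U))) eq)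
        (λ r → trans (U≡ (suc r)) (cong (rows TN) (+-suc k r))))
      (subst (WordState k 0) (sym (trans (U≡ 0) (cong (rows TN) (+-identityʳ k)))) (word-N k))

    Jk-state : ∀ {k} → k ≤ n → State k (rows (Jk n TM TN k))
    Jk-state {k} k≤n = Jm-state (n ∸ k) (m∸n+n≡m k≤n)

    -- Here a = i - j and z = n - i. The tail sums of J^(a+1) and J^a are measured from the same
    -- corner `F 0 n n`, which cancels.
    Rpat≡hat : ∀ r a z → suc r + a + z ≡ n →
      Rpat n TM TN (suc r + a) (suc r) ≡ hat n (octP n M N) (suc r + a) (suc r)
    Rpat≡hat r a z eq = begin
      + tailSum (Jk n TM TN (suc (r + a ∸ r))) (suc r) ℤ.- + tailSum (Jk n TM TN (r + a ∸ r)) (suc (suc r))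
        ≡⟨ cong (λ k → + tailSum (Jk n TM TN (suc k)) (suc r) ℤ.- + tailSum (Jk n TM TN k) (suc (suc r))) (m+n∸m≡n r a) ⟩
      + tailSum (Jk n TM TN (suc a)) (suc r) ℤ.- + tailSum (Jk n TM TN a) (suc (suc r))
        ≡⟨ cong₂ ℤ._-_
             (TailSums.tailSum-new {t = Jk n TM TN (suc a)} (Jk-state a<n) z r (trans (sum₁ z r a) eq))
             (TailSums.tailSum-new {t = Jk n TM TN a} (Jk-state (<⇒≤ a<n)) z (suc r) (trans (sum₂ z r a) eq)) ⟩
      (F 0 n n ℤ.- F (z + suc a) (r + suc a) (z + r)) ℤ.- (F 0 n n ℤ.- F (z + a) (suc r + a) (z + suc r))
        ≡⟨ cancel (F 0 n n) (F (z + suc a) (r + suc a) (z + r)) (F (z + a) (suc r + a) (z + suc r)) ⟩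
      F (z + a) (suc r + a) (z + suc r) ℤ.- F (z + suc a) (r + suc a) (z + r)
        ≡⟨ cong₂ ℤ._-_
             (F-cong (complement (suc r) (sum₃ z r a)) (complement z (sum₂ z r a)) (complement a (sum₅ z r a)))
             (F-cong (complement r (sum₆ z r a)) (trans (+-suc r a) (complement z (sum₂ z r a))) (complement (suc a) (sum₇ z r a))) ⟩
      octP n M N a (suc r) z ℤ.- octP n M N (suc a) r z
        ≡⟨ sym (hat-value (octP n M N) r a z eq) ⟩
      hat n (octP n M N) (suc r + a) (suc r) ∎
      where
      open ≡-Reasoning
      F-cong : ∀ {x x′ y y′ t t′} → x ≡ x′ → y ≡ y′ → t ≡ t′ → F x y t ≡ F x′ y′ t′
      F-cong refl refl refl = refl
      complement : ∀ m {k} → m + k ≡ suc r + a + z → k ≡ n ∸ m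
      complement m {k} p = trans (sym (m+n∸m≡n m k)) (cong (_∸ m) (trans p eq))
      sum₁ : ∀ z r a → z + (r + suc a) ≡ suc r + a + z
      sum₁ = solveℕ
      sum₂ : ∀ z r a → z + (suc r + a) ≡ suc r + a + z
      sum₂ = solveℕ
      sum₃ : ∀ z r a → suc r + (z + a) ≡ suc r + a + z
      sum₃ = solveℕ
      sum₅ : ∀ z r a → a + (z + suc r) ≡ suc r + a + z
      sum₅ = solveℕ
      sum₆ : ∀ z r a → r + (z + suc a) ≡ suc r + a + z
      sum₆ = solveℕ
      sum₇ : ∀ z r a → suc a + (z + r) ≡ suc r + a + z
      sum₇ = solveℕ
      a<n : a < n
      a<n = ≤-trans (s≤s (m≤n+m a r)) (≤-trans (m≤m+n (suc r + a) z) (≤-reflexive eq))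
      cancel : ∀ f x y → (f ℤ.- x) ℤ.- (f ℤ.- y) ≡ y ℤ.- x
      cancel = solve-∀

    cnt-J≡hat : ∀ r d → suc r + d ≤ n →
      + countLE (suc r + d) (rowAt (J (star TM TN)) (suc r)) ≡ hat n (octQ n M N) (suc r + d) (suc r)
    cnt-J≡hat r d p = begin
      + countLE (suc r + d) (rows (J (star TM TN)) r)
        ≡⟨ cong₂ (λ i s → + countLE (suc i) s) (+-comm r d) (rows-J TM TN GM.T-Tab GN.T-Tab r) ⟩
      + countLE (suc (d + r)) (insertRows TN (rows TM) r)
        ≡⟨ subst (λ r′ → + countLE (suc (d + r′)) (insertRows TN (rows TM) r) ≡
                         F (d + 0) (suc r′) (suc (d + r)) ℤ.- F (suc (d + 0)) r′ (suc (d + r)))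
             (+-identityʳ r)
             (RowState.new (insertRows-state TN |TN| (λ _ → refl) r) d
               (subst (λ i → suc i ≤ n) (trans (+-comm r d) (cong (λ r → d + r) (sym (+-identityʳ r)))) p)) ⟩
      F (d + 0) (suc r) (suc (d + r)) ℤ.- F (suc (d + 0)) r (suc (d + r))
        ≡⟨ cong₂ (λ x t → F x (suc r) t ℤ.- F (suc x) r t) (+-identityʳ d)
             (trans (cong suc (+-comm d r)) (sym (m∸[m∸n]≡n p))) ⟩
      octQ n M N d (suc r) z ℤ.- octQ n M N (suc d) r z
        ≡⟨ sym (hat-value (octQ n M N) r d z (m+[n∸m]≡n p)) ⟩
      hat n (octQ n M N) (suc r + d) (suc r) ∎
      where
      open ≡-Reasoning
      z = n ∸ (suc r + d)
      |TN| : length TN ≡ n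
      |TN| = trans (length-map (gtRow n (hat n N)) (applyUpTo suc n)) (length-applyUpTo suc n)

theorem7p9 : (n : ℕ) (lam mu nu delta rho : ℕ → ℕ) (M N : TriFun) →
    IsPartition n lam → IsPartition n mu → IsPartition n nu →
    IsPartition n delta → IsPartition n rho →
    InHIVE n rho lam delta M → InHIVE n delta mu nu N →
    (∀ k → k ≤ n → M k 0 (n ∸ k) ≡ N 0 k (n ∸ k)) →
    (∀ i j → 1 ≤ j → j ≤ i → i ≤ n →
    Rpat n (gtTableau n (hat n M)) (gtTableau n (hat n N)) i j
    ≡ hat n (octP n M N) i j)
    × (∀ i j → 1 ≤ j → j ≤ i → i ≤ n →
    + countLE i (rowAt (J (star (gtTableau n (hat n M)) (gtTableau n (hat n N)))) j)
    ≡ hat n (octQ n M N) i j)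
theorem7p9 n lam mu nu delta rho M N _ _ _ _ _ hM hN M≡N = R≡P , J≡Q
  where
  open Octahedron n M N M≡N
  gtM : IsGT n (hat n M)
  gtM = hive⇒IsGT (InHIVE.hive hM) (InHIVE.bdry-lam hM)
  gtN : IsGT n (hat n N)
  gtN = hive⇒IsGT (InHIVE.hive hN) (InHIVE.bdry-lam hN)
  R≡P : ∀ i j → 1 ≤ j → j ≤ i → i ≤ n →
    Rpat n (gtTableau n (hat n M)) (gtTableau n (hat n N)) i j ≡ hat n (octP n M N) i j
  R≡P i (suc r) _ j≤i i≤n with a , refl ← ≤⇒∃ j≤i with z , eq ← ≤⇒∃ i≤n = Rpat≡hat gtM gtN r a z eq
  J≡Q : ∀ i j → 1 ≤ j → j ≤ i → i ≤ n →
    + countLE i (rowAt (J (star (gtTableau n (hat n M)) (gtTableau n (hat n N)))) j) ≡ hat n (octQ n M N) i j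
  J≡Q i (suc r) _ j≤i i≤n with d , refl ← ≤⇒∃ j≤i = cnt-J≡hat gtM gtN r d i≤n
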